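{- For every integer $k\ge 3$, $src^*(C_{(k-1)^2}(\{1,k\})) = rc^*(C_{(k-1)^2}(\{1,k\})) = 2k-4$.
   Context: For an integer $n\ge 2$ and $S\subseteq\{1,\dots,n-1\}$, the circulant digraph $C_n(S)$ has vertex set $\{v_0,\dots,v_{n-1}\}$ and arcs $v_iv_j$ whenever $j-i\equiv s \pmod n$ for some $s\in S$. For an arc-colouring of a strongly connected digraph $D$, a directed path is rainbow if no two of its arcs have the same colour. $rc^*(D)$ is the minimum number of colours in an arc-colouring such that for every ordered pair of distinct vertices $x,y$ there is a rainbow directed $xy$-path. $src^*(D)$ is the minimum number of colours in an arc-colouring such that for every ordered pair of distinct vertices $x,y$ there is a rainbow directed $xy$-path of length equal to the directed distance $d_D(x,y)$. -}

module Defs where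

open import Data.Nat using (ℕ; zero; suc; _+_; _*_; _∸_; _≤_; _%_; NonZero)
open import Data.Fin using (Fin; toℕ)
open import Data.List using (List; []; _∷_; length)
open import Data.List.Membership.Propositional using (_∈_)
open import Data.List.Relation.Unary.Unique.Propositional using (Unique)
open import Data.Product using (Σ; ∃; _×_; _,_)
open import Relation.Binary.PropositionalEquality using (_≡_; _≢_)

-- Circulant digraph C_n(S): vertices v_0..v_{n-1} (as Fin n), arc v_i v_j
-- iff j - i ≡ s (mod n) for some s ∈ S, i.e. (i + s) mod n = j.
-- (S is given as a list of naturals; the paper requires S ⊆ {1,…,n-1}.)
CirculantArc : (n : ℕ) → .{{NonZero n}} → List ℕ → Fin n → Fin n → Set
CirculantArc n S i j = Σ ℕ λ s → s ∈ S × ((toℕ i + s) % n ≡ toℕ j)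

module _ {V : Set} (Arc : V → V → Set) where

  data Walk : V → V → Set where
    [] : ∀ {x} → Walk x x
    _∷_ : ∀ {x y z} → Arc x y → Walk y z → Walk x z

  vertices : ∀ {x y} → Walk x y → List V
  vertices {x} [] = x ∷ []
  vertices {x} (_ ∷ w) = x ∷ vertices w

  len : ∀ {x y} → Walk x y → ℕ
  len [] = 0
  len (_ ∷ w) = suc (len w)

  IsPath : ∀ {x y} → Walk x y → Set
  IsPath w = Unique (vertices w)

  -- colours of the arcs along a walk, for an arc-colouring col
  -- (an arc-colouring is given as a function on ordered vertex pairs;
  --  only its values on arcs matter)
  arcColours : ∀ {C : Set} → (V → V → C) → ∀ {x y} → Walk x y → List C
  arcColours col [] = []
  arcColours col {x} (_∷_ {y = y} _ w) = col x y ∷ arcColours col w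

  Rainbow : ∀ {C : Set} → (V → V → C) → ∀ {x y} → Walk x y → Set
  Rainbow col w = Unique (arcColours col w)

  IsGeodesic : ∀ {x y} → Walk x y → Set
  IsGeodesic {x} {y} w = (q : Walk x y) → IsPath q → len w ≤ len q

  RainbowConnectable : ℕ → Set
  RainbowConnectable c = Σ (V → V → Fin c) λ col →
    (x y : V) → x ≢ y → Σ (Walk x y) λ p → IsPath p × Rainbow col p

  StronglyRainbowConnectable : ℕ → Set
  StronglyRainbowConnectable c = Σ (V → V → Fin c) λ col →
    (x y : V) → x ≢ y →
      Σ (Walk x y) λ p → IsPath p × IsGeodesic p × Rainbow col p

IsMinimum : (ℕ → Set) → ℕ → Set
IsMinimum P m = P m × ((c : ℕ) → P c → m ≤ c)

RC* : {V : Set} → (V → V → Set) → ℕ → Set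
RC* Arc m = IsMinimum (RainbowConnectable Arc) m

SRC* : {V : Set} → (V → V → Set) → ℕ → Set
SRC* Arc m = IsMinimum (StronglyRainbowConnectable Arc) m

{-# OPTIONS --safe #-}
module Submission where

open import Defs
open import Data.Nat
open import Data.Nat.Properties
open import Data.Nat.DivMod
open import Data.Nat.ListAction using (sum)
open import Data.Nat.Tactic.RingSolver using (solve)
open import Data.Fin using (Fin; toℕ; fromℕ<)
import Data.Fin as Fin
import Data.Fin.Properties as Finₚ
open import Data.List using (List; []; _∷_; _++_; length; lookup; foldl; map; replicate)
import Data.List as List
open import Data.List.Membership.Propositional using (_∈_)
open import Data.List.Membership.Propositional.Properties using (∈-lookup)
open import Data.List.Relation.Unary.All as All using (All; []; _∷_)
import Data.List.Relation.Unary.All.Properties as Allₚ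
open import Data.List.Relation.Unary.AllPairs using ([]; _∷_)
open import Data.List.Relation.Unary.Any as Any using (Any; here; there)
open import Data.List.Relation.Unary.Unique.DecPropositional using (unique?)
open import Data.List.Relation.Unary.Unique.Propositional using (Unique)
import Data.List.Relation.Unary.Unique.Propositional.Properties as Uniqueₚ
open import Data.Product using (Σ; ∃; ∃₂; _×_; _,_; proj₁; proj₂; uncurry)
import Data.Product as Prod
open import Data.Sum using (_⊎_; inj₁; inj₂; [_,_])
open import Data.Vec using (Vec; []; _∷_)
import Data.Vec as Vec
open import Data.Empty using (⊥; ⊥-elim)
open import Data.Unit using (⊤; tt)
open import Relation.Nullary
open import Relation.Nullary.Decidable using (True; toWitness)
open import Relation.Binary using (tri<; tri≈; tri>)
open import Relation.Binary.PropositionalEquality hiding ([_])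
open import Function using (_∘_)

-- Put m = k - 1 = 2 + L, so that n = m * m.  An arc h adds 1 to the index of a vertex and an arc v
-- adds m + 1.  Both add 1 modulo m, so the length of a walk is determined modulo m by its ends, and
-- a walk with a arcs h and b arcs v is shortest whenever a ≤ m and b ≤ m - 2, or a = 0 and b = m - 1.
-- Every difference of two vertices is of this form, and (a , b) = (m , m - 2) gives the lower bound.
--
-- For m ≥ 4 write the vertices 0, …, n - 2 into m - 1 rows of length m + 1; the last vertex stays over.
-- An arc v leads to the next row and gets the colour A of its row.  An arc h gets a colour A only at
-- the two borders of its row (the last row is exceptional), and otherwise B or X, arranged so that
-- equally coloured arcs h are at least m arcs apart: X₀ X₁ move one column to the left from each row
-- to the next, and the B to their left move one by one to their right.  For m = 5 the colours of h are
--
--     A0 B0 B1 X₀ X₁ A0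
--     A1 B0 X₀ X₁ B1 A1
--     A2 X₀ X₁ B0 B1 A2
--     X₀ X₁ B0 A3 B1 A2   and X₁ at the last vertex, where v gets the colour B1.
--
-- Then one of the words vⁱ hᵃ vʲ with i + j = b is rainbow, except from the last column with a = m,
-- where a detour is needed.  The cases m = 2, 3 are settled by search.

-- [] and _∷_ are also constructors of Walk, All, AllPairs and Vec, which solve cannot disambiguate.
infixr 5 _∙_
pattern _∙_ x xs = x List.∷ xs
pattern ∅ = List.[]

-- Certificates for linear arithmetic: p ≤ q is a sum of known inequalities and r - l = (q - p) + c.
lin : ∀ {l r p q} c → p ≤ q → l + q + c ≡ r + p → l ≤ r
lin {l} {r} {p} {q} c p≤q eq = +-cancelʳ-≤ q l r
  (≤-trans (m≤m+n (l + q) c) (≤-trans (≤-reflexive eq) (+-monoʳ-≤ r p≤q)))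

lin-⊥ : ∀ {p q} c → p ≤ q → suc (q + c) ≡ p → ⊥
lin-⊥ {p} {q} c p≤q eq = <-irrefl refl (≤-trans (≤-trans (s≤s (m≤m+n q c)) (≤-reflexive eq)) p≤q)

infixl 6 _⊕_
_⊕_ : ∀ {p q p′ q′} → p ≤ q → p′ ≤ q′ → p + p′ ≤ q + q′
_⊕_ = +-mono-≤

-- Pigeonhole principle, and shortest walks as paths.

Unique⇒length≤ : ∀ {c} {xs : List (Fin c)} → Unique xs → length xs ≤ c
Unique⇒length≤ uniq = Finₚ.injective⇒≤ (lookup-injective uniq)
  where
  lookup-injective : ∀ {A : Set} {xs : List A} → Unique xs → ∀ {i j} → lookup xs i ≡ lookup xs j → i ≡ j
  lookup-injective (_ ∷ _) {Fin.zero} {Fin.zero} _ = refl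
  lookup-injective (x∉ ∷ _) {Fin.zero} {Fin.suc j} eq = ⊥-elim (All.lookup x∉ (∈-lookup j) eq)
  lookup-injective (x∉ ∷ _) {Fin.suc i} {Fin.zero} eq = ⊥-elim (All.lookup x∉ (∈-lookup i) (sym eq))
  lookup-injective (_ ∷ u) {Fin.suc i} {Fin.suc j} eq = cong Fin.suc (lookup-injective u eq)

module _ {V : Set} {Arc : V → V → Set} where

  -- Compared with all walks and not only with paths: arc counts are available for every walk, and
  -- the stronger bound yields both `IsPath` and `IsGeodesic`.
  Shortest : ∀ {x y} → Walk Arc x y → Set
  Shortest {x} {y} w = (q : Walk Arc x y) → len Arc w ≤ len Arc q

  suffix : ∀ {x y z} (w : Walk Arc x y) → z ∈ vertices Arc w → Σ (Walk Arc z y) λ q → len Arc q ≤ len Arc w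
  suffix [] (here refl) = [] , z≤n
  suffix (a ∷ w) (here refl) = a ∷ w , ≤-refl
  suffix (_ ∷ w) (there z∈w) = Prod.map₂ m≤n⇒m≤1+n (suffix w z∈w)

  -- If the first vertex recurred, the suffix from the later occurrence would be a strictly shorter
  -- walk between the same ends.
  shortest⇒path : ∀ {x y} (w : Walk Arc x y) → Shortest w → IsPath Arc w
  shortest⇒path [] _ = [] ∷ []
  shortest⇒path (a ∷ w) short =
    All.tabulate (λ z∈w x≡z → let q , q≤w = suffix w (subst (_∈ vertices Arc w) (sym x≡z) z∈w) in <⇒≱ (short q) q≤w)
    ∷ shortest⇒path w (λ q → s≤s⁻¹ (short (a ∷ q)))

  length-arcColours : ∀ {C : Set} (col : V → V → C) {x y} (w : Walk Arc x y) →
                      length (arcColours Arc col w) ≡ len Arc w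
  length-arcColours col [] = refl
  length-arcColours col (_ ∷ w) = cong suc (length-arcColours col w)

data Step : Set where
  h v : Step

-- Walks in the circulant digraph

module Circulant (L n : ℕ) .{{_ : NonZero n}} (n≡ : n ≡ (2 + L) * (2 + L)) where

  Arc : Fin n → Fin n → Set
  Arc = CirculantArc n (1 ∷ 3 + L ∷ [])

  size : Step → ℕ
  size h = 1
  size v = 3 + L

  next : Fin n → Step → Fin n
  next x s = (toℕ x + size s) mod n

  toℕ-mod : ∀ x → toℕ (x mod n) ≡ x % n
  toℕ-mod x = Finₚ.toℕ-fromℕ< (m%n<n x n)

  toℕ-% : ∀ (x : Fin n) → toℕ x % n ≡ toℕ x
  toℕ-% x = m<n⇒m%n≡m (Finₚ.toℕ<n x)

  arc : ∀ x s → Arc x (next x s)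
  arc x h = 1 , here refl , sym (toℕ-mod (toℕ x + 1))
  arc x v = 3 + L , there (here refl) , sym (toℕ-mod (toℕ x + (3 + L)))

  follow : Fin n → List Step → Fin n
  follow = foldl next

  walk : ∀ x w → Walk Arc x (follow x w)
  walk x [] = []
  walk x (s ∷ w) = arc x s ∷ walk (next x s) w

  len-walk : ∀ x w → len Arc (walk x w) ≡ length w
  len-walk x [] = refl
  len-walk x (s ∷ w) = cong suc (len-walk (next x s) w)

  %-+ˡ : ∀ a b → (a % n + b) % n ≡ (a + b) % n
  %-+ˡ a b = begin
    (a % n + b) % n            ≡⟨ %-distribˡ-+ (a % n) b n ⟩
    (a % n % n + b % n) % n    ≡⟨ cong (λ z → (z + b % n) % n) (m%n%n≡m%n a n) ⟩
    (a % n + b % n) % n        ≡⟨ %-distribˡ-+ a b n ⟨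
    (a + b) % n                ∎
    where open ≡-Reasoning

  amount : List Step → ℕ
  amount w = sum (map size w)

  toℕ-follow : ∀ x w → toℕ (follow x w) ≡ (toℕ x + amount w) % n
  toℕ-follow x [] = sym (trans (cong (_% n) (+-identityʳ (toℕ x))) (toℕ-% x))
  toℕ-follow x (s ∷ w) = begin
    toℕ (follow (next x s) w)                    ≡⟨ toℕ-follow (next x s) w ⟩
    (toℕ (next x s) + amount w) % n              ≡⟨ cong (λ z → (z + amount w) % n) (toℕ-mod (toℕ x + size s)) ⟩
    ((toℕ x + size s) % n + amount w) % n        ≡⟨ %-+ˡ (toℕ x + size s) (amount w) ⟩
    (toℕ x + size s + amount w) % n              ≡⟨ cong (_% n) (+-assoc (toℕ x) (size s) (amount w)) ⟩
    (toℕ x + (size s + amount w)) % n            ∎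
    where open ≡-Reasoning

  -- By commutativity the end of a walk depends only on how many arcs of size 1 and of size `3 + L`
  -- it has.
  length-counts : ∀ {x y} (q : Walk Arc x y) →
    ∃₂ λ a b → len Arc q ≡ a + b × (toℕ x + (a + b * (3 + L))) % n ≡ toℕ y
  length-counts {x} [] = 0 , 0 , refl , trans (cong (_% n) (+-identityʳ (toℕ x))) (toℕ-% x)
  length-counts {x} {y} (_∷_ {y = z} (s , s∈ , eq) q) with length-counts q
  ... | a , b , len≡ , end = count s∈
    where
    shift : ∀ c → s + (a + b * (3 + L)) ≡ c → (toℕ x + c) % n ≡ toℕ y
    shift _ refl = trans (cong (_% n) (sym (+-assoc (toℕ x) s (a + b * (3 + L)))))
      (trans (sym (%-+ˡ (toℕ x + s) (a + b * (3 + L)))) (trans (cong (λ t → (t + (a + b * (3 + L))) % n) eq) end))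
    count : s ∈ 1 ∷ 3 + L ∷ [] → ∃₂ λ a b → suc (len Arc q) ≡ a + b × (toℕ x + (a + b * (3 + L))) % n ≡ toℕ y
    count (here refl) = suc a , b , cong suc len≡ , shift (suc a + b * (3 + L)) refl
    count (there (here refl)) = a , suc b , trans (cong suc len≡) (sym (+-suc a b)) , shift (a + suc b * (3 + L)) (lemma (b * (3 + L)))
      where
      lemma : ∀ bk → 3 + L + (a + bk) ≡ a + (3 + L + bk)
      lemma bk = solve (L ∙ a ∙ bk ∙ ∅)

  ≡-mod : ∀ {x y} → x ≤ y → x % n ≡ y % n → ∃ λ c → y ≡ x + c * n
  ≡-mod {x} {y} x≤y eq = y / n ∸ x / n , (begin
    y                                      ≡⟨ m≡m%n+[m/n]*n y n ⟩
    y % n + y / n * n                      ≡⟨ cong₂ (λ r q → r + q * n) (sym eq) (sym (m+[n∸m]≡n (/-monoˡ-≤ n x≤y))) ⟩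
    x % n + (x / n + (y / n ∸ x / n)) * n  ≡⟨ cong (x % n +_) (*-distribʳ-+ n (x / n) _) ⟩
    x % n + (x / n * n + (y / n ∸ x / n) * n) ≡⟨ +-assoc (x % n) _ _ ⟨
    x % n + x / n * n + (y / n ∸ x / n) * n   ≡⟨ cong (_+ (y / n ∸ x / n) * n) (m≡m%n+[m/n]*n x n) ⟨
    x + (y / n ∸ x / n) * n                ∎)
    where open ≡-Reasoning

  -- Lengths of shortest walks.

  -- Remainder and quotient on division by `3 + L` of the numbers below `n = (1 + L) * (3 + L) + 1`;
  -- the second alternative is the largest of them.
  Region : ℕ → ℕ → Set
  Region a b = (a ≤ 2 + L × b ≤ L) ⊎ (a ≡ 0 × b ≡ suc L)

  target : ℕ → ℕ → ℕ
  target a b = a + b * (3 + L)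

  cofactor : ∀ {d b c} → suc d + b * (2 + L) ≡ c * (2 + L) →
             ∃ λ j → c ≡ suc (b + j) × suc d ≡ suc j * (2 + L)
  cofactor {d} {b} {c} eq
    with j , refl ← m≤n⇒∃[o]m+o≡n {suc b} {c} (*-cancelʳ-< (2 + L) b c (≤-trans (s≤s (m≤n+m _ d)) (≤-reflexive eq)))
    = j , refl , +-cancelʳ-≡ (b * (2 + L)) _ _ (trans eq (lemma (2 + L)))
    where
    lemma : ∀ m → suc (b + j) * m ≡ suc j * m + b * m
    lemma m = solve (b ∙ j ∙ m ∙ ∅)

  -- With `m = 2 + L`, a target is `a + b + b * m` and `n` is `m * m`, so a saving of `suc d` arcs
  -- is a positive multiple of `m`. If `b′ > b`, this forces `a > m`. In the second kind of region
  -- the whole length is only `m - 1`.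
  no-shortcut : ∀ {a b a′ b′ d} → Region a b → a + b ≡ a′ + b′ + suc d →
    ∀ c → target a′ b′ ≡ target a b + c * n ⊎ target a b ≡ target a′ b′ + c * n → ⊥
  no-shortcut {a} {b} {a′} {b′} {d} reg t≡ c (inj₁ eq) = contra reg (cofactor {d} {b + c * (2 + L)} {b′} eq′)
    where
    eq′ : suc d + (b + c * (2 + L)) * (2 + L) ≡ b′ * (2 + L)
    eq′ = +-cancelˡ-≡ (a′ + b′) _ _ (begin
      a′ + b′ + (suc d + (b + c * (2 + L)) * (2 + L))  ≡⟨ +-assoc (a′ + b′) (suc d) _ ⟨
      a′ + b′ + suc d + (b + c * (2 + L)) * (2 + L)    ≡⟨ cong (_+ (b + c * (2 + L)) * (2 + L)) t≡ ⟨
      a + b + (b + c * (2 + L)) * (2 + L)              ≡⟨ solve (a ∙ b ∙ c ∙ L ∙ ∅) ⟩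
      a + b * (3 + L) + c * ((2 + L) * (2 + L))        ≡⟨ cong (λ z → a + b * (3 + L) + c * z) n≡ ⟨
      a + b * (3 + L) + c * n                          ≡⟨ eq ⟨
      a′ + b′ * (3 + L)                                ≡⟨ solve (a′ ∙ b′ ∙ L ∙ ∅) ⟩
      a′ + b′ + b′ * (2 + L)                           ∎)
      where open ≡-Reasoning
    contra : Region a b → (∃ λ j → b′ ≡ suc (b + c * (2 + L) + j) × suc d ≡ suc j * (2 + L)) → ⊥
    contra (inj₁ (a≤ , _)) (j , b′≡ , d≡) = lin-⊥ (a′ + j + c * (2 + L) + j * (2 + L))
      (a≤ ⊕ ≤-reflexive (sym t≡) ⊕ ≤-reflexive (sym d≡) ⊕ ≤-reflexive (sym b′≡))
      (solve (a ∙ b ∙ a′ ∙ b′ ∙ d ∙ j ∙ c ∙ L ∙ ∅))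
    contra (inj₂ (refl , refl)) (j , _ , d≡) = lin-⊥ (a′ + b′ + j * (2 + L))
      (≤-reflexive (sym t≡) ⊕ ≤-reflexive (sym d≡)) (solve (a′ ∙ b′ ∙ d ∙ j ∙ L ∙ ∅))
  no-shortcut {a} {b} {a′} {b′} {d} reg t≡ c (inj₂ eq) = contra reg c (cofactor {d} {b} {b′ + c * (2 + L)} eq′)
    where
    eq′ : suc d + b * (2 + L) ≡ (b′ + c * (2 + L)) * (2 + L)
    eq′ = +-cancelˡ-≡ (a′ + b′) _ _ (begin
      a′ + b′ + (suc d + b * (2 + L))                  ≡⟨ +-assoc (a′ + b′) (suc d) _ ⟨
      a′ + b′ + suc d + b * (2 + L)                    ≡⟨ cong (_+ b * (2 + L)) t≡ ⟨
      a + b + b * (2 + L)                              ≡⟨ solve (a ∙ b ∙ L ∙ ∅) ⟩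
      a + b * (3 + L)                                  ≡⟨ eq ⟩
      a′ + b′ * (3 + L) + c * n                        ≡⟨ cong (λ z → a′ + b′ * (3 + L) + c * z) n≡ ⟩
      a′ + b′ * (3 + L) + c * ((2 + L) * (2 + L))      ≡⟨ solve (a′ ∙ b′ ∙ c ∙ L ∙ ∅) ⟩
      a′ + b′ + (b′ + c * (2 + L)) * (2 + L)           ∎)
      where open ≡-Reasoning
    contra : Region a b → ∀ c → (∃ λ j → b′ + c * (2 + L) ≡ suc (b + j) × suc d ≡ suc j * (2 + L)) → ⊥
    contra (inj₂ (refl , refl)) c (j , _ , d≡) = lin-⊥ (a′ + b′ + j * (2 + L))
      (≤-reflexive (sym t≡) ⊕ ≤-reflexive (sym d≡)) (solve (a′ ∙ b′ ∙ d ∙ j ∙ L ∙ ∅))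
    contra (inj₁ (a≤ , _)) zero (j , b′≡ , d≡) = lin-⊥ (a′ + j + j * (2 + L))
      (a≤ ⊕ ≤-reflexive (sym t≡) ⊕ ≤-reflexive (sym d≡) ⊕ ≤-reflexive (sym b′≡))
      (solve (a ∙ b ∙ a′ ∙ b′ ∙ d ∙ j ∙ L ∙ ∅))
    -- The longer walk goes around `suc c` times more. A saving of exactly `m` would give
    -- `b′ + suc c * m = suc b`, but `suc b < m`.
    contra (inj₁ (_ , b≤)) (suc c) (zero , b′≡ , _) = lin-⊥ (b′ + c * (2 + L))
      (b≤ ⊕ ≤-reflexive b′≡) (solve (b ∙ b′ ∙ c ∙ L ∙ ∅))
    -- A saving of at least `2 * m` exceeds `a + b`, which is at most `2 * m - 2`.
    contra (inj₁ (a≤ , b≤)) (suc c) (suc j , _ , d≡) = lin-⊥ (suc (a′ + b′ + j * (2 + L)))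
      (a≤ ⊕ b≤ ⊕ ≤-reflexive (sym t≡) ⊕ ≤-reflexive (sym d≡))
      (solve (a ∙ b ∙ a′ ∙ b′ ∙ d ∙ j ∙ L ∙ ∅))

  geodesic : ∀ {x a b a′ b′} → Region a b →
    (x + target a b) % n ≡ (x + target a′ b′) % n → a + b ≤ a′ + b′
  geodesic {x} {a} {b} {a′} {b′} reg eq = ≮⇒≥ λ t′<t →
    let d , t≡ = m≤n⇒∃[o]m+o≡n t′<t
    in uncurry (no-shortcut {a} {b} {a′} {b′} {d} reg (trans (sym t≡) (sym (+-suc (a′ + b′) d)))) difference
    where
    cancel : ∀ {s t} c → x + t ≡ x + s + c * n → t ≡ s + c * n
    cancel {s} {t} c e = +-cancelˡ-≡ x t _ (trans e (+-assoc x s (c * n)))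
    difference : ∃ λ c → target a′ b′ ≡ target a b + c * n ⊎ target a b ≡ target a′ b′ + c * n
    difference with ≤-total (x + target a b) (x + target a′ b′)
    ... | inj₁ le = let c , e = ≡-mod le eq in c , inj₁ (cancel {target a b} {target a′ b′} c e)
    ... | inj₂ le = let c , e = ≡-mod le (sym eq) in c , inj₂ (cancel {target a′ b′} {target a b} c e)

  -- Division is by `m = 2 + L`. For `d = r + q * m` take `b = q` and `a = r - q` if `q ≤ r`;
  -- otherwise give back one `m`, with `b = q - 1` and `a = m + r - b`.
  represent : ∀ d → d < n → ∃₂ λ a b → Region a b × target a b ≡ d
  represent d d<n = rep (d % (2 + L)) (d / (2 + L)) (s≤s⁻¹ (m%n<n d (2 + L)))
    (s≤s⁻¹ (m<n*o⇒m/o<n (≤-trans d<n (≤-reflexive n≡)))) (m≡m%n+[m/n]*n d (2 + L))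
    where
    rep : ∀ r q → r ≤ suc L → q ≤ suc L → d ≡ r + q * (2 + L) → ∃₂ λ a b → Region a b × a + b * (3 + L) ≡ d
    rep r q r≤ q≤ refl with q ≤? r
    rep r q r≤ q≤ refl | yes q≤r with o , refl ← m≤n⇒∃[o]m+o≡n q≤r with q ≤? L
    ... | yes q≤L = o , q , inj₁ (lin (suc q) r≤ (solve (o ∙ q ∙ L ∙ ∅)) , q≤L) , solve (o ∙ q ∙ L ∙ ∅)
    ... | no q≰L with refl ← ≤-antisym q≤ (≰⇒> q≰L)
                 with refl ← n≤0⇒n≡0 {o} (lin 0 r≤ (solve (o ∙ L ∙ ∅))) = 0 , suc L , inj₂ (refl , refl) , solve (L ∙ ∅)
    rep r (suc q) r≤ q≤ refl | no q≰r with o , refl ← m≤n⇒∃[o]m+o≡n (s≤s⁻¹ (≰⇒> q≰r))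
                               with a , e ← m≤n⇒∃[o]m+o≡n (≤-trans (m≤n+m o r) (s≤s⁻¹ q≤))
      = 2 + a , r + o , inj₁ (lin o (≤-reflexive e) (solve (a ∙ o ∙ L ∙ ∅)) , s≤s⁻¹ q≤) , (begin
        2 + a + (r + o) * (3 + L)              ≡⟨ solve (a ∙ r ∙ o ∙ L ∙ ∅) ⟩
        2 + (o + a) + r + (r + o) * (2 + L)    ≡⟨ cong (λ z → 2 + z + r + (r + o) * (2 + L)) e ⟩
        2 + L + r + (r + o) * (2 + L)          ≡⟨ solve (r ∙ o ∙ L ∙ ∅) ⟩
        r + suc (r + o) * (2 + L)              ∎)
      where open ≡-Reasoning
    rep r zero r≤ q≤ refl | no q≰r = ⊥-elim (q≰r z≤n)

  reach : ∀ (x y : Fin n) → ∃₂ λ a b → Region a b × (toℕ x + target a b) % n ≡ toℕ y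
  reach x y = let a , b , reg , e = represent ((toℕ y + (n ∸ toℕ x)) % n) (m%n<n (toℕ y + (n ∸ toℕ x)) n) in a , b , reg , (begin
    (toℕ x + target a b) % n                     ≡⟨ cong (λ d → (toℕ x + d) % n) e ⟩
    (toℕ x + (toℕ y + (n ∸ toℕ x)) % n) % n      ≡⟨ cong (_% n) (+-comm (toℕ x) _) ⟩
    ((toℕ y + (n ∸ toℕ x)) % n + toℕ x) % n      ≡⟨ %-+ˡ (toℕ y + (n ∸ toℕ x)) (toℕ x) ⟩
    (toℕ y + (n ∸ toℕ x) + toℕ x) % n            ≡⟨ cong (_% n) (+-assoc (toℕ y) _ (toℕ x)) ⟩
    (toℕ y + (n ∸ toℕ x + toℕ x)) % n            ≡⟨ cong (λ z → (toℕ y + z) % n) (m∸n+n≡m (<⇒≤ (Finₚ.toℕ<n x))) ⟩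
    (toℕ y + n) % n                              ≡⟨ [m+n]%n≡m%n (toℕ y) n ⟩
    toℕ y % n                                    ≡⟨ toℕ-% y ⟩
    toℕ y                                        ∎)
    where open ≡-Reasoning

  region-shortest : ∀ {x y a b} → Region a b → (toℕ x + target a b) % n ≡ toℕ y →
                    (p : Walk Arc x y) → len Arc p ≡ a + b → Shortest p
  region-shortest {x} {a = a} {b} reg end p len≡ q =
    let a′ , b′ , len′ , end′ = length-counts q in
    subst₂ _≤_ (sym len≡) (sym len′) (geodesic {toℕ x} {a} {b} {a′} {b′} reg (trans end (sym end′)))

  -- A colouring sees only the two ends of an arc, so the arcs h and v from a vertex need different
  -- heads. They have them because `n` does not divide `2 + L`.
  next-v≢next-h : ∀ x → next x v ≢ next x h
  next-v≢next-h x eq = contra (≡-mod (+-monoʳ-≤ (toℕ x) (s≤s z≤n)) (trans (sym (toℕ-mod (toℕ x + 1))) (trans (cong toℕ (sym eq)) (toℕ-mod (toℕ x + (3 + L))))))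
    where
    contra : (∃ λ c → toℕ x + (3 + L) ≡ toℕ x + 1 + c * n) → ⊥
    contra (zero , e) = lin-⊥ (suc L) (≤-reflexive (+-cancelˡ-≡ (toℕ x) _ _ (trans e (+-assoc (toℕ x) 1 0)))) (solve (L ∙ ∅))
    contra (suc c , e) = lin-⊥ (1 + 3 * L + L * L + c * ((2 + L) * (2 + L)))
      (≤-reflexive (sym e′)) (solve (c ∙ L ∙ ∅))
      where
      e′ : 3 + L ≡ 1 + suc c * ((2 + L) * (2 + L))
      e′ = +-cancelˡ-≡ (toℕ x) _ _ (trans e (trans (+-assoc (toℕ x) 1 (suc c * n)) (cong (λ z → toℕ x + (1 + suc c * z)) n≡)))

  -- From rainbow words to colourings, and the lower bound.

  module _ {K : ℕ} (c : Step → Fin n → Fin K) where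

    colours : Fin n → List Step → List (Fin K)
    colours x [] = []
    colours x (s ∷ w) = c s x ∷ colours (next x s) w

    colouring : Fin n → Fin n → Fin K
    colouring x y with y Finₚ.≟ next x h
    ... | yes _ = c h x
    ... | no _ = c v x

    colouring-next : ∀ x s → colouring x (next x s) ≡ c s x
    colouring-next x s with next x s Finₚ.≟ next x h
    colouring-next x h | yes _ = refl
    colouring-next x v | yes eq = ⊥-elim (next-v≢next-h x eq)
    colouring-next x h | no ¬eq = ⊥-elim (¬eq refl)
    colouring-next x v | no _ = refl

    arcColours-walk : ∀ x w → arcColours Arc colouring (walk x w) ≡ colours x w
    arcColours-walk x [] = refl
    arcColours-walk x (s ∷ w) = cong₂ _∷_ (colouring-next x s) (arcColours-walk (next x s) w)

    RainbowWord : Fin n → ℕ → ℕ → Set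
    RainbowWord x a b = ∃ λ w → follow x w ≡ (toℕ x + target a b) mod n × length w ≡ a + b × Unique (colours x w)

    stronglyConnectable : (∀ x a b → Region a b → RainbowWord x a b) → StronglyRainbowConnectable Arc K
    stronglyConnectable word = colouring , λ x y _ →
      let a , b , reg , end = reach x y
          w , w-end , w-len , uniq = word x a b reg
      in connect a b reg w end (trans w-end (Finₚ.toℕ-injective (trans (toℕ-mod (toℕ x + target a b)) end))) w-len uniq
      where
      connect : ∀ {x y} a b → Region a b → ∀ w → (toℕ x + target a b) % n ≡ toℕ y → follow x w ≡ y → length w ≡ a + b →
        Unique (colours x w) → Σ (Walk Arc x y) λ p → IsPath Arc p × IsGeodesic Arc p × Rainbow Arc colouring p
      connect {x} a b reg w end refl w-len uniq =
        walk x w , shortest⇒path (walk x w) short , (λ q _ → short q) , subst Unique (sym (arcColours-walk x w)) uniq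
        where
        short : Shortest (walk x w)
        short = region-shortest reg end (walk x w) (trans (len-walk x w) w-len)

  -- The vertex given by `a = 2 + L` and `b = L` is `2 + L + L` arcs away from vertex 0, and a
  -- rainbow walk has as many colours as arcs.
  lower-bound : ∀ c → RainbowConnectable Arc c → 2 + L + L ≤ c
  lower-bound c (col , connect) =
    let x = 0 mod n
        x≡0 = trans (toℕ-mod 0) (m<n⇒m%n≡m (>-nonZero⁻¹ n))
        y = target (2 + L) L mod n
        end = sym (toℕ-mod (target (2 + L) L))
        p , _ , rainbow = connect x y λ x≡y →
          1+n≰n (≤-trans (s≤s z≤n) (geodesic {0} {2 + L} {L} {0} {0} (inj₁ (≤-refl , ≤-refl)) (trans end (trans (cong toℕ (sym x≡y)) (toℕ-mod 0)))))
        a′ , b′ , len′ , end′ = length-counts p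
    in ≤-trans (≤-trans (geodesic {0} {2 + L} {L} {a′} {b′} (inj₁ (≤-refl , ≤-refl))
         (trans end (sym (trans (cong (λ z → (z + target a′ b′) % n) (sym x≡0)) end′))))
         (≤-reflexive (trans (sym len′) (sym (length-arcColours col p)))))
         (Unique⇒length≤ rainbow)

  minimum : StronglyRainbowConnectable Arc (2 + L + L) → SRC* Arc (2 + L + L) × RC* Arc (2 + L + L)
  minimum strong = (strong , λ c → lower-bound c ∘ weaken) , (weaken strong , lower-bound)
    where
    weaken : ∀ {c} → StronglyRainbowConnectable Arc c → RainbowConnectable Arc c
    weaken = Prod.map₂ λ connect x y x≢y → Prod.map₂ (λ (path , _ , rainbow) → path , rainbow) (connect x y x≢y)

-- Cells, colours and counted words.

-- at u w is the vertex u + w * (3 + L) with u ≤ 2 + L and w ≤ L, and corner is the last vertex.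
data Cell : Set where
  at : ℕ → ℕ → Cell
  corner : Cell

data Colour : Set where
  A B : ℕ → Colour
  X₀ X₁ : Colour

data Counts : List Step → ℕ → ℕ → Set where
  [] : Counts [] 0 0
  h∷_ : ∀ {w a b} → Counts w a b → Counts (h ∷ w) (suc a) b
  v∷_ : ∀ {w a b} → Counts w a b → Counts (v ∷ w) a (suc b)

counts-h : ∀ i {w a b} → Counts w a b → Counts (replicate i h ++ w) (i + a) b
counts-h zero c = c
counts-h (suc i) c = h∷ counts-h i c

counts-v : ∀ i {w a b} → Counts w a b → Counts (replicate i v ++ w) a (i + b)
counts-v zero c = c
counts-v (suc i) c = v∷ counts-v i c

counts-replicate-v : ∀ i → Counts (replicate i v) 0 i
counts-replicate-v zero = []
counts-replicate-v (suc i) = v∷ counts-replicate-v i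

counts-length : ∀ {w a b} → Counts w a b → length w ≡ a + b
counts-length [] = refl
counts-length (h∷ c) = cong suc (counts-length c)
counts-length {a = a} {suc b} (v∷ c) = trans (cong suc (counts-length c)) (sym (+-suc a b))

≡≤ : ∀ {m n : ℕ} → m ≡ n → m ≤ n
≡≤ = ≤-reflexive

≡≥ : ∀ {m n : ℕ} → m ≡ n → n ≤ m
≡≥ eq = ≤-reflexive (sym eq)

-- Geometry of the grid for `m ≥ 4`.

module Grid (l L : ℕ) (L≡ : L ≡ 2 + l) where

  data Valid : Cell → Set where
    corner : Valid corner
    at : ∀ {u w} → u ≤ 2 + L → w ≤ L → Valid (at u w)

  hstep : Cell → Cell
  hstep corner = at 0 0
  hstep (at u w) with u <? 2 + L | w <? L
  ... | yes _ | _ = at (suc u) w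
  ... | no _ | yes _ = at 0 (suc w)
  ... | no _ | no _ = corner

  -- The rows hold `n - 1` vertices, so an arc v out of the last row comes back to row 0 one column
  -- further left, and from column 0 it leads to `corner`.
  vstep : Cell → Cell
  vstep corner = at (2 + L) 0
  vstep (at u w) with w <? L
  vstep (at u w) | yes _ = at u (suc w)
  vstep (at zero w) | no _ = corner
  vstep (at (suc u) w) | no _ = at u 0

  hstep-right : ∀ {u w} → u < 2 + L → hstep (at u w) ≡ at (suc u) w
  hstep-right {u} {w} u< with u <? 2 + L | w <? L
  ... | yes _ | _ = refl
  ... | no u≮ | _ = ⊥-elim (u≮ u<)

  hstep-up : ∀ {w} → w < L → hstep (at (2 + L) w) ≡ at 0 (suc w)
  hstep-up {w} w< with 2 + L <? 2 + L | w <? L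
  ... | yes p | _ = ⊥-elim (<-irrefl refl p)
  ... | no _ | yes _ = refl
  ... | no _ | no w≮ = ⊥-elim (w≮ w<)

  hstep-last : hstep (at (2 + L) L) ≡ corner
  hstep-last with 2 + L <? 2 + L | L <? L
  ... | yes p | _ = ⊥-elim (<-irrefl refl p)
  ... | no _ | yes p = ⊥-elim (<-irrefl refl p)
  ... | no _ | no _ = refl

  vstep-up : ∀ {u w} → w < L → vstep (at u w) ≡ at u (suc w)
  vstep-up {u} {w} w< with w <? L
  ... | yes _ = refl
  ... | no w≮ = ⊥-elim (w≮ w<)

  vstep-left : ∀ {u} → vstep (at (suc u) L) ≡ at u 0
  vstep-left with L <? L
  ... | yes p = ⊥-elim (<-irrefl refl p)
  ... | no _ = refl

  vstep-corner : vstep (at 0 L) ≡ corner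
  vstep-corner with L <? L
  ... | yes p = ⊥-elim (<-irrefl refl p)
  ... | no _ = refl

  hsteps vsteps : ℕ → Cell → Cell
  hsteps zero s = s
  hsteps (suc k) s = hsteps k (hstep s)
  vsteps zero s = s
  vsteps (suc k) s = vsteps k (vstep s)

  hsteps-+ : ∀ j k s → hsteps (j + k) s ≡ hsteps k (hsteps j s)
  hsteps-+ zero k s = refl
  hsteps-+ (suc j) k s = hsteps-+ j k (hstep s)

  vsteps-+ : ∀ j k s → vsteps (j + k) s ≡ vsteps k (vsteps j s)
  vsteps-+ zero k s = refl
  vsteps-+ (suc j) k s = vsteps-+ j k (vstep s)

  hsteps-right : ∀ k {u w} → u + k ≤ 2 + L → hsteps k (at u w) ≡ at (u + k) w
  hsteps-right zero {u} {w} _ = cong (λ c → at c w) (sym (+-identityʳ u))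
  hsteps-right (suc k) {u} {w} u+k≤ rewrite +-suc u k =
    trans (cong (hsteps k) (hstep-right (≤-trans (s≤s (m≤m+n u k)) u+k≤))) (hsteps-right k u+k≤)

  hsteps-to-end : ∀ k j {u w} → u + k ≡ 2 + L → hsteps (k + suc j) (at u w) ≡ hsteps j (hstep (at (2 + L) w))
  hsteps-to-end k j {u} {w} eq = trans (hsteps-+ k (suc j) (at u w))
    (cong (hsteps (suc j)) (trans (hsteps-right k (≡≤ eq)) (cong (λ c → at c w) eq)))

  hsteps-up : ∀ k {u w c} → w < L → u ≤ 2 + L → u + k ≡ 3 + L + c → c ≤ 2 + L → hsteps k (at u w) ≡ at c (suc w)
  hsteps-up k {u} {w} {c} w< u≤ eq c≤ with d , e ← m≤n⇒∃[o]m+o≡n u≤ = begin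
    hsteps k (at u w)               ≡⟨ cong (λ j → hsteps j (at u w)) (+-cancelˡ-≡ u k (d + suc c) k≡) ⟩
    hsteps (d + suc c) (at u w)     ≡⟨ hsteps-to-end d c e ⟩
    hsteps c (hstep (at (2 + L) w)) ≡⟨ cong (hsteps c) (hstep-up w<) ⟩
    hsteps c (at 0 (suc w))         ≡⟨ hsteps-right c c≤ ⟩
    at c (suc w)                    ∎
    where
    open ≡-Reasoning
    k≡ : u + k ≡ u + (d + suc c)
    k≡ = trans eq (trans (cong (λ z → suc z + c) (sym e)) (solve (u ∙ d ∙ c ∙ ∅)))

  hsteps-corner : ∀ k {u} → u ≤ 2 + L → u + k ≡ 3 + L → hsteps k (at u L) ≡ corner
  hsteps-corner k {u} u≤ eq with d , e ← m≤n⇒∃[o]m+o≡n u≤ = begin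
    hsteps k (at u L)        ≡⟨ cong (λ j → hsteps j (at u L)) (+-cancelˡ-≡ u k (d + 1) (trans eq (trans (cong suc (sym e)) (solve (u ∙ d ∙ ∅))))) ⟩
    hsteps (d + 1) (at u L)  ≡⟨ hsteps-to-end d 0 e ⟩
    hstep (at (2 + L) L)     ≡⟨ hstep-last ⟩
    corner                   ∎
    where open ≡-Reasoning

  hsteps-over : ∀ k {u c} → u ≤ 2 + L → u + k ≡ 4 + L + c → c ≤ 2 + L → hsteps k (at u L) ≡ at c 0
  hsteps-over k {u} {c} u≤ eq c≤ with d , e ← m≤n⇒∃[o]m+o≡n u≤ = begin
    hsteps k (at u L)                     ≡⟨ cong (λ j → hsteps j (at u L)) (+-cancelˡ-≡ u k (d + (2 + c)) (trans eq (trans (cong (λ z → 2 + z + c) (sym e)) (solve (u ∙ d ∙ c ∙ ∅))))) ⟩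
    hsteps (d + (2 + c)) (at u L)         ≡⟨ hsteps-to-end d (suc c) e ⟩
    hsteps (suc c) (hstep (at (2 + L) L)) ≡⟨ cong (hsteps (suc c)) hstep-last ⟩
    hsteps c (at 0 0)                     ≡⟨ hsteps-right c c≤ ⟩
    at c 0                                ∎
    where open ≡-Reasoning

  -- A run of at most `2 + L` arcs h passes the end of a row at most once; only from the last row
  -- can it meet `corner` and return to row 0.
  data Reach (u w k : ℕ) : Cell → Set where
    right : u + k ≤ 2 + L → Reach u w k (at (u + k) w)
    up : ∀ {c} → w < L → u + k ≡ 3 + L + c → c ≤ 2 + L → Reach u w k (at c (suc w))
    last : w ≡ L → u + k ≡ 3 + L → Reach u w k corner
    over : ∀ {c} → w ≡ L → u + k ≡ 4 + L + c → c ≤ 2 + L → Reach u w k (at c 0)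

  reach-cell : ∀ {u w} k → u ≤ 2 + L → w ≤ L → k ≤ 2 + L → Reach u w k (hsteps k (at u w))
  reach-cell {u} {w} k u≤ w≤ k≤ with u + k ≤? 2 + L
  ... | yes p = subst (Reach u w k) (sym (hsteps-right k p)) (right p)
  ... | no ¬p with c , e ← m≤n⇒∃[o]m+o≡n (≰⇒> ¬p) with w <? L
  ...   | yes w< = subst (Reach u w k) (sym (hsteps-up k w< u≤ (sym e) c≤)) (up w< (sym e) c≤)
    where
    c≤ : c ≤ 2 + L
    c≤ = lin 1 (u≤ ⊕ k≤ ⊕ ≡≤ e) (solve (c ∙ u ∙ k ∙ L ∙ ∅))
  ...   | no w≮ with refl ← ≤-antisym w≤ (≮⇒≥ w≮) = top c e
    where
    top : ∀ c → 3 + L + c ≡ u + k → Reach u L k (hsteps k (at u L))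
    top zero e = subst (Reach u L k) (sym (hsteps-corner k u≤ e′)) (last refl e′)
      where e′ = trans (sym e) (+-identityʳ (3 + L))
    top (suc c) e = subst (Reach u L k) (sym (hsteps-over k u≤ e′ c≤)) (over refl e′ c≤)
      where
      e′ : u + k ≡ 4 + L + c
      e′ = trans (sym e) (+-suc (3 + L) c)
      c≤ : c ≤ 2 + L
      c≤ = lin 2 (u≤ ⊕ k≤ ⊕ ≡≤ e) (solve (c ∙ u ∙ k ∙ L ∙ ∅))

  hstep-valid : ∀ {s} → Valid s → Valid (hstep s)
  hstep-valid corner = at z≤n z≤n
  hstep-valid (at {u} {w} u≤ w≤) with u <? 2 + L | w <? L
  ... | yes u< | _ = at u< w≤
  ... | no _ | yes w< = at z≤n w<
  ... | no _ | no _ = corner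

  hsteps-valid : ∀ k {s} → Valid s → Valid (hsteps k s)
  hsteps-valid zero val = val
  hsteps-valid (suc k) val = hsteps-valid k (hstep-valid val)

  vstep-valid : ∀ {s} → Valid s → Valid (vstep s)
  vstep-valid corner = at ≤-refl z≤n
  vstep-valid (at {u} {w} u≤ w≤) with w <? L
  vstep-valid (at u≤ w≤) | yes w< = at u≤ w<
  vstep-valid (at {zero} u≤ w≤) | no _ = corner
  vstep-valid (at {suc u} u≤ w≤) | no _ = at (<⇒≤ u≤) z≤n

  vstep≡hsteps : ∀ {s} → Valid s → vstep s ≡ hsteps (3 + L) s
  vstep≡hsteps corner = sym (hsteps-right (2 + L) {0} ≤-refl)
  vstep≡hsteps (at {u} {w} u≤ w≤) with m≤n⇒m<n∨m≡n w≤
  ... | inj₁ w< = trans (vstep-up w<) (sym (hsteps-up (3 + L) w< u≤ (+-comm u (3 + L)) u≤))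
  vstep≡hsteps (at {zero} u≤ w≤) | inj₂ refl = trans vstep-corner (sym (hsteps-corner (3 + L) u≤ refl))
  vstep≡hsteps (at {suc u} u≤ w≤) | inj₂ refl =
    trans vstep-left (sym (hsteps-over (3 + L) u≤ (solve (u ∙ L ∙ ∅)) (<⇒≤ u≤)))

  vsteps≡hsteps : ∀ k {s} → Valid s → vsteps k s ≡ hsteps (k * (3 + L)) s
  vsteps≡hsteps zero val = refl
  vsteps≡hsteps (suc k) {s} val = trans (vsteps≡hsteps k (vstep-valid val))
    (trans (cong (hsteps (k * (3 + L))) (vstep≡hsteps val)) (sym (hsteps-+ (3 + L) (k * (3 + L)) s)))

  vsteps-up : ∀ k {u w} → w + k ≤ L → vsteps k (at u w) ≡ at u (w + k)
  vsteps-up zero {u} {w} _ = cong (at u) (sym (+-identityʳ w))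
  vsteps-up (suc k) {u} {w} w+k≤ rewrite +-suc w k =
    trans (cong (vsteps k) (vstep-up (≤-trans (s≤s (m≤m+n w k)) w+k≤))) (vsteps-up k w+k≤)

  vsteps-top : ∀ d {u w} → w + d ≡ L → vsteps (suc d) (at u w) ≡ vstep (at u L)
  vsteps-top d {u} {w} eq = begin
    vsteps (suc d) (at u w)      ≡⟨ cong (λ k → vsteps k (at u w)) (+-comm 1 d) ⟩
    vsteps (d + 1) (at u w)      ≡⟨ vsteps-+ d 1 (at u w) ⟩
    vstep (vsteps d (at u w))    ≡⟨ cong vstep (vsteps-up d (≡≤ eq)) ⟩
    vstep (at u (w + d))         ≡⟨ cong (vstep ∘ at u) eq ⟩
    vstep (at u L)               ∎
    where open ≡-Reasoning

  -- Since `n = (1 + L) * (3 + L) + 1`, one can climb column 0 by `1 + L` arcs v up to `corner`,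
  -- from which one arc h returns to the start.
  hsteps-period : hsteps ((2 + L) * (2 + L)) (at 0 0) ≡ at 0 0
  hsteps-period = begin
    hsteps ((2 + L) * (2 + L)) (at 0 0)              ≡⟨ cong (λ k → hsteps k (at 0 0)) eq ⟩
    hsteps (suc L * (3 + L) + 1) (at 0 0)            ≡⟨ hsteps-+ (suc L * (3 + L)) 1 (at 0 0) ⟩
    hstep (hsteps (suc L * (3 + L)) (at 0 0))        ≡⟨ cong hstep (vsteps≡hsteps (suc L) (at z≤n z≤n)) ⟨
    hstep (vsteps (suc L) (at 0 0))                  ≡⟨ cong hstep (vsteps-top L refl) ⟩
    hstep (vstep (at 0 L))                           ≡⟨ cong hstep vstep-corner ⟩
    at 0 0                                           ∎
    where
    open ≡-Reasoning
    eq : (2 + L) * (2 + L) ≡ suc L * (3 + L) + 1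
    eq = solve (L ∙ ∅)

  -- The colours of the arcs.

  -- In the clause for B (i ∸ 2) one has suc i + w > suc L and w < L, hence i ≥ 2.
  innerRow : ℕ → ℕ → Colour
  innerRow zero w = A w
  innerRow (suc i) w with i ≟ suc L | <-cmp (suc i + w) L | i + w ≟ L
  ... | yes _ | _ | _ = A w
  ... | no _ | tri< _ _ _ | _ = B i
  ... | no _ | tri≈ _ _ _ | _ = X₀
  ... | no _ | tri> _ _ _ | yes _ = X₁
  ... | no _ | tri> _ _ _ | no _ = B (i ∸ 2)

  -- The diagonals of `X₀` and `X₁` arrive at columns 0 and 1 here, so the left border is taken and
  -- the two colours A stand in columns `L` and `2 + L`.
  lastRow : ℕ → Colour
  lastRow zero = X₀
  lastRow (suc zero) = X₁
  lastRow (suc (suc i)) with <-cmp (2 + i) L | 2 + i ≟ suc L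
  ... | tri< _ _ _ | _ = B i
  ... | tri≈ _ _ _ | _ = A L
  ... | tri> _ _ _ | yes _ = B l
  ... | tri> _ _ _ | no _ = A (suc l)

  hcol vcol : Cell → Colour
  hcol corner = X₁
  hcol (at u w) with w <? L
  ... | yes _ = innerRow u w
  ... | no _ = lastRow u
  vcol corner = B l
  vcol (at u w) = A w

  -- Necessary conditions on the position of each colour, stated as equations so that two cells of
  -- one colour can be matched together. `B i` is in column `1 + i` left of `X₀` (`pre`), in column
  -- `2 + i` of the last row (`mid`), and in column `3 + i` right of `X₁` (`post`, which also covers
  -- `B l` in the last row).
  data HCol : Cell → Colour → Set where
    corner : HCol corner X₁
    x₀ : ∀ {u w} → u + w ≡ L → HCol (at u w) X₀
    x₁ : ∀ {u w} → u + w ≡ suc L → HCol (at u w) X₁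
    side : ∀ {u w r} → w < L → u ≡ 0 ⊎ u ≡ 2 + L → r ≡ w → HCol (at u w) (A r)
    lastL : ∀ {u w r} → w ≡ L → u ≡ L → r ≡ L → HCol (at u w) (A r)
    lastR : ∀ {u w r} → w ≡ L → u ≡ 2 + L → suc r ≡ L → HCol (at u w) (A r)
    pre : ∀ {u w i} → u ≡ suc i → 2 + i + w ≤ L → HCol (at u w) (B i)
    mid : ∀ {u w i} → u ≡ 2 + i → w ≡ L → 3 + i ≤ L → HCol (at u w) (B i)
    post : ∀ {u w i} → u ≡ 3 + i → L ≤ suc (i + w) → 2 + i ≤ L → w < L ⊎ 2 + i ≡ L → HCol (at u w) (B i)

  hcol-HCol : ∀ {s} → Valid s → HCol s (hcol s)
  hcol-HCol corner = corner
  hcol-HCol (at {u} {w} u≤ w≤) with w <? L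
  ... | yes w< = inner u u≤
    where
    inner : ∀ u → u ≤ 2 + L → HCol (at u w) (innerRow u w)
    inner zero _ = side w< (inj₁ refl) refl
    inner (suc i) u≤ with i ≟ suc L | <-cmp (suc i + w) L | i + w ≟ L
    ... | yes i≡ | _ | _ = side w< (inj₂ (cong suc i≡)) refl
    ... | no _ | tri< p _ _ | _ = pre refl p
    ... | no _ | tri≈ _ p _ | _ = x₀ p
    ... | no _ | tri> _ _ _ | yes p = x₁ (cong suc p)
    ... | no i≢ | tri> _ _ q | no p
      with i+w> ← ≤∧≢⇒< (s≤s⁻¹ q) (p ∘ sym)
      with j , refl ← m≤n⇒∃[o]m+o≡n {2} {i} (lin 0 (i+w> ⊕ w<) (solve (i ∙ w ∙ L ∙ ∅)))
      = post refl (s≤s⁻¹ i+w>) (s≤s⁻¹ (≤∧≢⇒< (s≤s⁻¹ u≤) i≢)) (inj₁ w<)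
  ... | no w≮ with refl ← ≤-antisym w≤ (≮⇒≥ w≮) = final u u≤
    where
    final : ∀ u → u ≤ 2 + L → HCol (at u L) (lastRow u)
    final zero _ = x₀ refl
    final (suc zero) _ = x₁ refl
    final (suc (suc i)) u≤ with <-cmp (2 + i) L | 2 + i ≟ suc L
    ... | tri< p _ _ | _ = mid refl refl p
    ... | tri≈ _ p _ | _ = lastL refl p refl
    ... | tri> _ _ _ | yes p = post (trans p (cong suc L≡)) (m≤n⇒m≤1+n (m≤n+m L l)) (≡≥ L≡) (inj₂ (sym L≡))
    ... | tri> _ _ p | no q = lastR refl (≤-antisym u≤ (≤∧≢⇒< p (q ∘ sym))) (sym L≡)

  -- Separation of equally coloured arcs h.

  -- Only the two borders of a row below the last share a colour; all other pairs of cases are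
  -- contradictory.
  hcol-same-row : ∀ {u u′ w c} → HCol (at u w) c → HCol (at u′ w) c → u < u′ → 2 + L + u ≤ u′
  hcol-same-row {u} {u′} {w} (x₀ e) (x₀ e′) u< = ⊥-elim (<-irrefl (+-cancelʳ-≡ w u u′ (trans e (sym e′))) u<)
  hcol-same-row {u} {u′} {w} (x₁ e) (x₁ e′) u< = ⊥-elim (<-irrefl (+-cancelʳ-≡ w u u′ (trans e (sym e′))) u<)
  hcol-same-row (side _ (inj₁ refl) _) (side _ (inj₁ refl) _) ()
  hcol-same-row (side _ (inj₁ refl) _) (side _ (inj₂ refl) _) _ = ≡≤ (+-identityʳ (2 + L))
  hcol-same-row (side _ (inj₂ refl) _) (side _ (inj₁ refl) _) ()
  hcol-same-row (side _ (inj₂ refl) _) (side _ (inj₂ refl) _) u< = ⊥-elim (<-irrefl refl u<)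
  hcol-same-row (side w< _ _) (lastL w≡ _ _) _ = ⊥-elim (<-irrefl w≡ w<)
  hcol-same-row (side w< _ _) (lastR w≡ _ _) _ = ⊥-elim (<-irrefl w≡ w<)
  hcol-same-row (lastL w≡ _ _) (side w< _ _) _ = ⊥-elim (<-irrefl w≡ w<)
  hcol-same-row (lastR w≡ _ _) (side w< _ _) _ = ⊥-elim (<-irrefl w≡ w<)
  hcol-same-row (lastL _ refl _) (lastL _ refl _) u< = ⊥-elim (<-irrefl refl u<)
  hcol-same-row (lastR _ refl _) (lastR _ refl _) u< = ⊥-elim (<-irrefl refl u<)
  hcol-same-row (lastL _ _ r≡) (lastR _ _ r≡′) _ = ⊥-elim (1+n≰n (≡≤ (trans r≡′ (sym r≡))))
  hcol-same-row (lastR _ _ r≡) (lastL _ _ r≡′) _ = ⊥-elim (1+n≰n (≡≤ (trans r≡ (sym r≡′))))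
  hcol-same-row (pre refl _) (pre refl _) u< = ⊥-elim (<-irrefl refl u<)
  hcol-same-row (mid refl _ _) (mid refl _ _) u< = ⊥-elim (<-irrefl refl u<)
  hcol-same-row (post refl _ _ _) (post refl _ _ _) u< = ⊥-elim (<-irrefl refl u<)
  hcol-same-row {w = w} (pre {i = i} _ p) (mid _ w≡ _) _ = ⊥-elim (lin-⊥ (suc i) (p ⊕ ≡≥ w≡) (solve (i ∙ w ∙ L ∙ ∅)))
  hcol-same-row {w = w} (mid {i = i} _ w≡ _) (pre _ p) _ = ⊥-elim (lin-⊥ (suc i) (p ⊕ ≡≥ w≡) (solve (i ∙ w ∙ L ∙ ∅)))
  hcol-same-row {w = w} (pre {i = i} _ p) (post _ q _ _) _ = ⊥-elim (lin-⊥ 0 (p ⊕ q) (solve (i ∙ w ∙ L ∙ ∅)))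
  hcol-same-row {w = w} (post {i = i} _ q _ _) (pre _ p) _ = ⊥-elim (lin-⊥ 0 (p ⊕ q) (solve (i ∙ w ∙ L ∙ ∅)))
  hcol-same-row (mid _ w≡ _) (post _ _ _ (inj₁ w<)) _ = ⊥-elim (<-irrefl w≡ w<)
  hcol-same-row (mid _ _ i<) (post _ _ _ (inj₂ i≡)) _ = ⊥-elim (<-irrefl i≡ i<)
  hcol-same-row (post _ _ _ (inj₁ w<)) (mid _ w≡ _) _ = ⊥-elim (<-irrefl w≡ w<)
  hcol-same-row (post _ _ _ (inj₂ i≡)) (mid _ _ i<) _ = ⊥-elim (<-irrefl i≡ i<)

  B-column : ∀ {u w i} → HCol (at u w) (B i) → suc i ≤ u × u ≤ 3 + i
  B-column {i = i} (pre refl _) = ≤-refl , m≤n+m (suc i) 2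
  B-column {i = i} (mid refl _ _) = n≤1+n (suc i) , n≤1+n (2 + i)
  B-column {i = i} (post refl _ _ _) = m≤n+m (suc i) 2 , ≤-refl

  -- Used with `B-late`: column `3 + i` requires `w ≥ L - 1 - i` and column `1 + i` requires
  -- `w ≤ L - 2 - i`, so `B i` never falls back from the former to the latter in the next row.
  B-early : ∀ {u w i} → HCol (at u w) (B i) → u ≤ 2 + i ⊎ L ≤ suc (i + w)
  B-early {i = i} (pre refl _) = inj₁ (n≤1+n (suc i))
  B-early (mid refl _ _) = inj₁ ≤-refl
  B-early (post _ p _ _) = inj₂ p

  B-late : ∀ {u w i} → HCol (at u w) (B i) → 2 + i ≤ u ⊎ 2 + i + w ≤ L
  B-late (pre _ p) = inj₂ p
  B-late (mid refl _ _) = inj₁ ≤-refl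
  B-late {i = i} (post refl _ _ _) = inj₁ (n≤1+n (2 + i))

  A-column : ∀ {u w r} → HCol (at u w) (A r) → u ≤ 2 + L
  A-column (side _ (inj₁ refl) _) = z≤n
  A-column (side _ (inj₂ refl) _) = ≤-refl
  A-column (lastL _ refl _) = m≤n+m L 2
  A-column (lastR _ refl _) = ≤-refl

  A-row : ∀ {u w r} → HCol (at u w) (A r) → w < L → r ≡ w
  A-row (side _ _ r≡) _ = r≡
  A-row (lastL w≡ _ _) w< = ⊥-elim (<-irrefl w≡ w<)
  A-row (lastR w≡ _ _) w< = ⊥-elim (<-irrefl w≡ w<)

  A-row-last : ∀ {u r} → HCol (at u L) (A r) → L ≤ suc r
  A-row-last (side w< _ _) = ⊥-elim (<-irrefl refl w<)
  A-row-last (lastL _ _ refl) = n≤1+n L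
  A-row-last (lastR _ _ r≡) = ≡≥ r≡

  -- The arc h at (u′ , suc w) comes u′ + (3 + L) - u arcs after the one at (u , w): at least 2 + L.
  hcol-next-row : ∀ {u u′ w c} → HCol (at u w) c → HCol (at u′ (suc w)) c → w < L → u ≤ suc u′
  hcol-next-row {u} {u′} {w} (x₀ e) (x₀ e′) _ = lin 0 (≡≤ e ⊕ ≡≥ e′) (solve (u ∙ u′ ∙ w ∙ L ∙ ∅))
  hcol-next-row {u} {u′} {w} (x₁ e) (x₁ e′) _ = lin 0 (≡≤ e ⊕ ≡≥ e′) (solve (u ∙ u′ ∙ w ∙ L ∙ ∅))
  hcol-next-row {u} {u′} {w} {A r} p q w< with A-row p w<
  hcol-next-row p (side _ _ r≡) w< | e = ⊥-elim (<-irrefl (trans (sym e) r≡) ≤-refl)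
  hcol-next-row p (lastL _ _ r≡) w< | e = ⊥-elim (<-irrefl (trans (sym e) r≡) w<)
  hcol-next-row p (lastR _ refl _) w< | e = m≤n⇒m≤1+n (A-column p)
  hcol-next-row {u} {u′} {w} {B i} p q w< with B-early p | B-late q
  ... | inj₁ u≤ | _ = ≤-trans u≤ (s≤s (proj₁ (B-column q)))
  ... | inj₂ _ | inj₁ u≥ = ≤-trans (proj₂ (B-column p)) (s≤s u≥)
  ... | inj₂ L≤ | inj₂ ≤L = ⊥-elim (lin-⊥ 1 (L≤ ⊕ ≤L) (solve (i ∙ w ∙ L ∙ ∅)))

  -- From the last row to row 0 the run also passes `corner`, which makes `u′ + (4 + L) - u` arcs;
  -- the bound says that these are at least `2 + L`. The colours A cannot coincide: row 0 has only
  -- `A 0`, the last row only `A L` and `A (L - 1)`.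
  hcol-wrap : ∀ {u u′ c} → HCol (at u L) c → HCol (at u′ 0) c → u ≤ 2 + u′
  hcol-wrap {u} (x₀ e) (x₀ _) = ≤-trans (≡≤ (+-cancelʳ-≡ L u 0 e)) z≤n
  hcol-wrap {u} (x₁ e) (x₁ _) = ≤-trans (≡≤ (+-cancelʳ-≡ L u 1 e)) (s≤s z≤n)
  hcol-wrap {c = A r} p q with refl ← A-row q (≤-trans (s≤s z≤n) (≡≥ L≡)) = ⊥-elim (lin-⊥ l (A-row-last p ⊕ ≡≥ L≡) (solve (l ∙ L ∙ ∅)))
  hcol-wrap {c = B i} p q = ≤-trans (proj₂ (B-column p)) (s≤s (s≤s (proj₁ (B-column q))))

  -- The two cases with `corner` concern `X₁`, which is in column `1 + L` of row 0 and in column 1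
  -- of the last row, both exactly `2 + L` arcs away from `corner`.
  hcol-separated : ∀ k {s c} → Valid s → 0 < k → k ≤ suc L → HCol s c → HCol (hsteps k s) c → ⊥
  hcol-separated (suc k) corner _ k< corner q = contra (subst (λ t → HCol t X₁) (hsteps-right k {0} (m≤n⇒m≤1+n (≤-trans (s≤s⁻¹ k<) (n≤1+n L)))) q)
    where
    contra : HCol (at k 0) X₁ → ⊥
    contra (x₁ e) = <-irrefl (trans (sym (+-identityʳ k)) e) k<
  hcol-separated k {at u w} (at u≤ w≤) k>0 k≤ p q with hsteps k (at u w) | reach-cell k u≤ w≤ (m≤n⇒m≤1+n k≤)
  ... | _ | right _ = lin-⊥ 0 (hcol-same-row p q (m<m+n u k>0) ⊕ k≤) (solve (u ∙ k ∙ L ∙ ∅))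
  ... | at c _ | up w< e _ = lin-⊥ 0 (hcol-next-row p q w< ⊕ ≡≥ e ⊕ k≤) (solve (u ∙ k ∙ c ∙ L ∙ ∅))
  ... | at c _ | over refl e _ = lin-⊥ 0 (hcol-wrap p q ⊕ ≡≥ e ⊕ k≤) (solve (u ∙ k ∙ c ∙ L ∙ ∅))
  ... | corner | last refl e = contra p q
    where
    contra : ∀ {c} → HCol (at u L) c → HCol corner c → ⊥
    contra (x₁ e′) corner = lin-⊥ 0 (≡≤ e′ ⊕ ≡≥ e ⊕ k≤) (solve (u ∙ k ∙ L ∙ ∅))

  -- Colours along runs of equal arcs.

  hcols vcols : ℕ → Cell → List Colour
  hcols zero s = []
  hcols (suc k) s = hcol s ∷ hcols k (hstep s)
  vcols zero s = []
  vcols (suc k) s = vcol s ∷ vcols k (vstep s)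

  hcols-All : ∀ {P : Colour → Set} a {s} → Valid s →
              (∀ k → k < a → ∀ {c} → HCol (hsteps k s) c → P c) → All P (hcols a s)
  hcols-All zero _ _ = []
  hcols-All (suc a) val p = p 0 (s≤s z≤n) (hcol-HCol val) ∷ hcols-All a (hstep-valid val) (λ k k< → p (suc k) (s≤s k<))

  hcols-unique : ∀ a {s} → Valid s → a ≤ 2 + L → Unique (hcols a s)
  hcols-unique zero _ _ = []
  hcols-unique (suc a) {s} val a≤ =
    hcols-All a (hstep-valid val) (λ k k< q eq → hcol-separated (suc k) val (s≤s z≤n) (≤-trans k< (s≤s⁻¹ a≤)) (hcol-HCol val) (subst (HCol (hsteps k (hstep s))) (sym eq) q))
    ∷ hcols-unique a (hstep-valid val) (<⇒≤ a≤)

  vcols-+ : ∀ i j s → vcols (i + j) s ≡ vcols i s ++ vcols j (vsteps i s)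
  vcols-+ zero j s = refl
  vcols-+ (suc i) j s = cong (vcol s ∷_) (vcols-+ i j (vstep s))

  -- Colours of runs of arcs v: A r with R r, and B l (from corner) only if S.
  data Uses (R : ℕ → Set) (S : Set) : Colour → Set where
    row : ∀ {r} → R r → Uses R S (A r)
    special : S → Uses R S (B l)

  Run : (ℕ → Set) → Set → List Colour → Set
  Run R S cs = Unique cs × All (Uses R S) cs

  weaken : ∀ {R R′ : ℕ → Set} {S S′ : Set} {cs} → (∀ {r} → R r → R′ r) → (S → S′) → Run R S cs → Run R′ S′ cs
  weaken f g (uniq , all) = uniq , All.map (λ { (row p) → row (f p) ; (special s) → special (g s) }) all

  unique-++ : ∀ {P Q : Colour → Set} {xs ys} → Unique xs → Unique ys → All P xs → All Q ys →
              (∀ {c} → P c → Q c → ⊥) → Unique (xs ++ ys)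
  unique-++ uxs uys pxs qys disj = Uniqueₚ.++⁺ uxs uys λ (∈xs , ∈ys) → disj (All.lookup pxs ∈xs) (All.lookup qys ∈ys)

  disjoint : ∀ {R R′ : ℕ → Set} {S S′ : Set} → (∀ {r} → R r → R′ r → ⊥) → (S → S′ → ⊥) →
             ∀ {c} → Uses R S c → Uses R′ S′ c → ⊥
  disjoint f g (row p) (row q) = f p q
  disjoint f g (special s) (special s′) = g s s′

  append : ∀ {R R′ : ℕ → Set} {S S′ : Set} {xs ys} → Run R S xs → Run R′ S′ ys →
           (∀ {r} → R r → R′ r → ⊥) → (S → S′ → ⊥) → Run (λ r → R r ⊎ R′ r) (S ⊎ S′) (xs ++ ys)
  append run@(u , p) run′@(u′ , p′) f g = unique-++ u u′ p p′ (disjoint f g)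
    , Allₚ.++⁺ (proj₂ (weaken inj₁ inj₁ run)) (proj₂ (weaken inj₂ inj₂ run′))

  -- The bound is `suc L` and not `L` because the arc v that leaves the last row still has the
  -- colour `A L` of that row.
  run-up : ∀ i {u w} → w + i ≤ suc L → Run (λ r → w ≤ r × r < w + i) ⊥ (vcols i (at u w))
  run-up zero _ = [] , []
  run-up (suc zero) {u} {w} _ = [] ∷ [] , row (≤-refl , m<m+n w (s≤s z≤n)) ∷ []
  run-up (suc (suc i)) {u} {w} w+i≤ =
    subst (λ t → Run R ⊥ (A w ∷ vcols (suc i) t)) (sym (vstep-up w<)) (extend (run-up (suc i) {u} {suc w} (≤-trans (≡≥ (+-suc w (suc i))) w+i≤)))
    where
    R : ℕ → Set
    R r = w ≤ r × r < w + suc (suc i)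
    w< : w < L
    w< = lin i w+i≤ (solve (w ∙ i ∙ L ∙ ∅))
    extend : ∀ {cs} → Run (λ r → suc w ≤ r × r < suc w + suc i) ⊥ cs → Run R ⊥ (A w ∷ cs)
    extend (uniq , all) = All.map (λ { (row (p , _)) refl → 1+n≰n p }) all ∷ uniq
      , row (≤-refl , m<m+n w (s≤s z≤n)) ∷ proj₂ (weaken (λ (p , q) → <⇒≤ p , ≤-trans q (≡≥ (+-suc w (suc i)))) (λ ()) (uniq , all))

  end-left : ∀ d {j u w} → w + d ≡ L → j ≤ L → vsteps (suc d + j) (at (suc u) w) ≡ at u j
  end-left d {j} {u} {w} eq j≤ = trans (vsteps-+ (suc d) j (at (suc u) w))
    (trans (cong (vsteps j) (trans (vsteps-top d eq) vstep-left)) (vsteps-up j j≤))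

  end-corner : ∀ d {j w} → w + d ≡ L → j ≤ L → vsteps (suc d + suc j) (at 0 w) ≡ at (2 + L) j
  end-corner d {j} {w} eq j≤ = trans (vsteps-+ (suc d) (suc j) (at 0 w))
    (trans (cong (vsteps (suc j)) (trans (vsteps-top d eq) vstep-corner)) (vsteps-up j j≤))

  -- The run takes `A w`, ..., `A L`, re-enters one column to the left and takes `A 0`, ...,
  -- `A (j - 1)`; `j ≤ w` keeps the two ranges apart.
  run-left : ∀ d {j u w} → w + d ≡ L → j ≤ w → Run (λ r → w ≤ r ⊎ r < j) ⊥ (vcols (suc d + j) (at (suc u) w))
  run-left d {j} {u} {w} eq j≤ = subst (Run _ ⊥) (sym (vcols-+ (suc d) j (at (suc u) w)))
    (weaken [ inj₁ ∘ proj₁ , inj₂ ∘ proj₂ ] [ (λ ()) , (λ ()) ]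
      (append (run-up (suc d) (≡≤ (trans (+-suc w d) (cong suc eq))))
        (subst (λ t → Run (λ r → 0 ≤ r × r < j) ⊥ (vcols j t)) (sym (trans (vsteps-top d eq) vstep-left))
          (run-up j (≤-trans j≤ (m≤n⇒m≤1+n (≤-trans (m≤m+n w d) (≡≤ eq))))))
        (λ (p , _) (_ , q) → 1+n≰n (≤-trans q (≤-trans j≤ p))) (λ ())))

  run-corner : ∀ {j} → j ≤ suc L → Run (_< j) ⊤ (vcols (suc j) corner)
  run-corner {j} j≤ = let uniq , all = run-up j {2 + L} {0} j≤ in
    All.map (λ { (row _) () }) all ∷ uniq , special tt ∷ proj₂ (weaken proj₂ (λ ()) (uniq , all))

  -- As in `run-left`, but from column 0 the arc at `corner` lies between the two ranges and adds
  -- `B l`.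
  run-through-corner : ∀ d {j w} → w + d ≡ L → j ≤ w → Run (λ r → w ≤ r ⊎ r < j) ⊤ (vcols (suc d + suc j) (at 0 w))
  run-through-corner d {j} {w} eq j≤ = subst (Run _ ⊤) (sym (vcols-+ (suc d) (suc j) (at 0 w)))
    (weaken [ inj₁ ∘ proj₁ , inj₂ ] (λ _ → tt)
      (append (run-up (suc d) (≡≤ (trans (+-suc w d) (cong suc eq))))
        (subst (λ t → Run (_< j) ⊤ (vcols (suc j) t)) (sym (trans (vsteps-top d eq) vstep-corner))
          (run-corner (≤-trans j≤ (m≤n⇒m≤1+n (≤-trans (m≤m+n w d) (≡≤ eq))))))
        (λ (p , _) q → 1+n≰n (≤-trans q (≤-trans j≤ p))) (λ ())))

  -- In `beyond`, `suc d` arcs v lead out of the last row and `j` arcs remain.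
  data Split (w b : ℕ) : Set where
    below : w + b ≤ L → Split w b
    beyond : ∀ d j → w + d ≡ L → b ≡ suc d + j → Split w b

  split : ∀ {w} b → w ≤ L → Split w b
  split {w} b w≤ with w + b ≤? L
  ... | yes p = below p
  ... | no ¬p with d , e ← m≤n⇒∃[o]m+o≡n w≤ | j , e′ ← m≤n⇒∃[o]m+o≡n (≰⇒> ¬p) =
    beyond d j e (+-cancelˡ-≡ w b (suc d + j) (trans (sym e′) (trans (cong (λ z → suc z + j) (sym e)) (solve (w ∙ d ∙ j ∙ ∅)))))

  beyond-≤ : ∀ {w d j b} → b ≤ L → w + d ≡ L → b ≡ suc d + j → j < w
  beyond-≤ {w} {d} {j} {b} b≤ e e′ = lin 0 (b≤ ⊕ ≡≥ e ⊕ ≡≥ e′) (solve (w ∙ d ∙ j ∙ b ∙ L ∙ ∅))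

  unique-v : ∀ {s} b → Valid s → b ≤ suc L → Unique (vcols b s)
  unique-v zero _ _ = []
  unique-v (suc b) corner b≤ = proj₁ (run-corner (m≤n⇒m≤1+n (s≤s⁻¹ b≤)))
  unique-v b (at u≤ w≤) b≤ with split b w≤
  ... | below p = proj₁ (run-up b (m≤n⇒m≤1+n p))
  unique-v b (at {suc u} {w} u≤ w≤) b≤ | beyond d j e refl = proj₁ (run-left d {j} e (lin 0 (b≤ ⊕ ≡≥ e) (solve (w ∙ d ∙ j ∙ L ∙ ∅))))
  unique-v b (at {zero} {w} u≤ w≤) b≤ | beyond d (suc j) e refl = proj₁ (run-through-corner d {j} e (lin 1 (b≤ ⊕ ≡≥ e) (solve (w ∙ d ∙ j ∙ L ∙ ∅))))
  unique-v b (at {zero} {w} u≤ w≤) b≤ | beyond d zero e refl = subst (λ i → Unique (vcols i (at 0 w))) (sym (+-identityʳ (suc d)))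
    (proj₁ (run-up (suc d) (≡≤ (trans (+-suc w d) (cong suc e)))))

  -- Colours along mixed words.

  cols : Cell → List Step → List Colour
  cols s [] = []
  cols s (h ∷ w) = hcol s ∷ cols (hstep s) w
  cols s (v ∷ w) = vcol s ∷ cols (vstep s) w

  cols-h : ∀ a s w → cols s (replicate a h ++ w) ≡ hcols a s ++ cols (hsteps a s) w
  cols-h zero s w = refl
  cols-h (suc a) s w = cong (hcol s ∷_) (cols-h a (hstep s) w)

  cols-v : ∀ a s w → cols s (replicate a v ++ w) ≡ vcols a s ++ cols (vsteps a s) w
  cols-v zero s w = refl
  cols-v (suc a) s w = cong (vcol s ∷_) (cols-v a (vstep s) w)

  cols-replicate-v : ∀ j s → cols s (replicate j v) ≡ vcols j s
  cols-replicate-v zero s = refl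
  cols-replicate-v (suc j) s = cong (vcol s ∷_) (cols-replicate-v j (vstep s))

  Rainbows : Cell → ℕ → ℕ → Set
  Rainbows s a b = ∃ λ w → Counts w a b × Unique (cols s w)

  -- For the word vⁱ hᵃ w. The arcs h are rainbow among themselves by separation, so what remains is
  -- that the three pieces have pairwise disjoint colours. The last piece is arbitrary to allow for
  -- the detour.
  rainbow-word : ∀ {R R′ S S′} s {t} i a w {a′ b′} → Valid t → a ≤ 2 + L → vsteps i s ≡ t → Counts w a′ b′ →
    Run R S (vcols i s) → Run R′ S′ (cols (hsteps a t) w) →
    (∀ {r} → R r → R′ r → ⊥) → (S → S′ → ⊥) →
    (∀ k → k < a → ∀ {c} → HCol (hsteps k t) c → Uses R S c → ⊥) →
    (∀ k → k < a → ∀ {c} → HCol (hsteps k t) c → Uses R′ S′ c → ⊥) →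
    Rainbows s (a + a′) (i + b′)
  rainbow-word s i a w val a≤ refl counts (u , p) (u′ , p′) f g disj disj′ =
    replicate i v ++ replicate a h ++ w
    , counts-v i (counts-h a counts)
    , subst Unique (sym (trans (cols-v i s (replicate a h ++ w)) (cong (vcols i s ++_) (cols-h a (vsteps i s) w))))
        (unique-++ u (unique-++ (hcols-unique a val a≤) u′ (hcols-All a val disj′) p′ (λ ¬q q → ¬q q)) p
          (Allₚ.++⁺ (hcols-All a val disj) (All.map (λ q p → disjoint f g p q) p′)) (λ q ¬q → ¬q q))

  rainbow-vhv : ∀ {R R′ S S′} s {t t′} i a j → Valid t → a ≤ 2 + L → vsteps i s ≡ t → hsteps a t ≡ t′ →
    Run R S (vcols i s) → Run R′ S′ (vcols j t′) →
    (∀ {r} → R r → R′ r → ⊥) → (S → S′ → ⊥) →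
    (∀ k → k < a → ∀ {c} → HCol (hsteps k t) c → Uses R S c → ⊥) →
    (∀ k → k < a → ∀ {c} → HCol (hsteps k t) c → Uses R′ S′ c → ⊥) →
    Rainbows s a (i + j)
  rainbow-vhv s {t} i a j val a≤ e refl run run′ f g disj disj′ = subst (λ a → Rainbows s a (i + j)) (+-identityʳ a)
    (rainbow-word s i a (replicate j v) val a≤ e (counts-replicate-v j) run
      (subst (Run _ _) (sym (cols-replicate-v j (hsteps a t))) run′) f g disj disj′)

  rainbow-vh : ∀ {R S} s {t} i a → Valid t → a ≤ 2 + L → vsteps i s ≡ t → Run R S (vcols i s) →
    (∀ k → k < a → ∀ {c} → HCol (hsteps k t) c → Uses R S c → ⊥) → Rainbows s a i
  rainbow-vh s i a val a≤ e run disj = subst (Rainbows s a) (+-identityʳ i)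
    (rainbow-vhv {R′ = λ _ → ⊥} {S′ = ⊥} s i a 0 val a≤ e refl run ([] , []) (λ _ ()) (λ _ ()) disj (λ { _ _ _ (row ()) ; _ _ _ (special ()) }))

  rainbow-hv : ∀ {R S} s {t} a j → Valid s → a ≤ 2 + L → hsteps a s ≡ t → Run R S (vcols j t) →
    (∀ k → k < a → ∀ {c} → HCol (hsteps k s) c → Uses R S c → ⊥) → Rainbows s a j
  rainbow-hv s a j val a≤ e run disj =
    rainbow-vhv {R = λ _ → ⊥} {S = ⊥} s 0 a j val a≤ refl e ([] , []) run (λ ()) (λ ()) (λ { _ _ _ (row ()) ; _ _ _ (special ()) }) disj

  -- Colours met by a run of arcs h.

  A-above : ∀ {u w r} → HCol (at u w) (A r) → u < 2 + L → w ≤ r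
  A-above (side _ _ refl) _ = ≤-refl
  A-above (lastL refl _ refl) _ = ≤-refl
  A-above (lastR _ refl _) u< = ⊥-elim (<-irrefl refl u<)

  A-border : ∀ {u w r} → w < L → HCol (at u w) (A r) → u ≡ 0 ⊎ u ≡ 2 + L
  A-border w< (side _ p _) = p
  A-border w< (lastL w≡ _ _) = ⊥-elim (<-irrefl w≡ w<)
  A-border w< (lastR w≡ _ _) = ⊥-elim (<-irrefl w≡ w<)

  B-special : ∀ {u w} → 0 < w → HCol (at u w) (B l) → suc L ≤ u
  B-special {w = w} w> (pre _ p) = ⊥-elim (lin-⊥ 0 (p ⊕ ≡≤ L≡ ⊕ w>) (solve (l ∙ w ∙ L ∙ ∅)))
  B-special w> (mid _ _ p) = ⊥-elim (<-irrefl (sym L≡) p)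
  B-special w> (post refl _ _ _) = s≤s (≡≤ L≡)

  -- Passing to the next row can only raise the index; `A (L - 1)` in the last row causes no
  -- exception, as that row is entered from row `L - 1`.
  reach-≥ : ∀ {u w k t r} → w < L → Reach u w k t → HCol t (A r) → w ≤ r
  reach-≥ w< (right _) p = ≡≥ (A-row p w<)
  reach-≥ {w = w} w< (up {c} _ _ _) p with m≤n⇒m<n∨m≡n w<
  ... | inj₁ w+1< = ≤-trans (n≤1+n w) (≡≥ (A-row p w+1<))
  ... | inj₂ refl = s≤s⁻¹ (A-row-last p)
  reach-≥ w< (last w≡ _) _ = ⊥-elim (<-irrefl w≡ w<)
  reach-≥ w< (over w≡ _ _) _ = ⊥-elim (<-irrefl w≡ w<)

  -- The bound on `u + k` stops before column `L` of the last row, the only place where an arc h has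
  -- colour `A L`. This leaves `A L` to the arc v out of that row.
  reach-< : ∀ {u w k t r} → w < L → u + k < 3 + L + L → Reach u w k t → HCol t (A r) → r < L
  reach-< w< _ (right _) p with refl ← A-row p w< = w<
  reach-< {u} {w} {k} w< u+k< (up {c} _ e _) (side w+1< _ refl) = w+1<
  reach-< {u} {w} {k} w< u+k< (up {c} _ e _) (lastL _ c≡ _) = ⊥-elim (lin-⊥ 0 (u+k< ⊕ ≡≥ e ⊕ ≡≥ c≡) (solve (u ∙ k ∙ c ∙ L ∙ ∅)))
  reach-< w< _ (up _ _ _) (lastR _ _ r≡) = ≡≤ r≡
  reach-< w< _ (last w≡ _) _ = ⊥-elim (<-irrefl w≡ w<)
  reach-< w< _ (over w≡ _ _) _ = ⊥-elim (<-irrefl w≡ w<)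

  reach-avoid : ∀ {u w} {P : Colour → Set} a → u ≤ 2 + L → w ≤ L → a ≤ 2 + L →
    (∀ k → k < a → ∀ {t c} → Reach u w k t → HCol t c → P c → ⊥) →
    ∀ k → k < a → ∀ {c} → HCol (hsteps k (at u w)) c → P c → ⊥
  reach-avoid a u≤ w≤ a≤ f k k< = f k k< (reach-cell k u≤ w≤ (<⇒≤ (≤-trans k< a≤)))

  -- Rainbow words by starting cell.

  rainbows-h : ∀ {s} a → Valid s → a ≤ 2 + L → Rainbows s a 0
  rainbows-h {s} a val a≤ = rainbow-vh {R = λ _ → ⊥} {S = ⊥} s 0 a val a≤ refl ([] , []) (λ { _ _ _ (row ()) ; _ _ _ (special ()) })

  rainbows-v : ∀ {s} b → Valid s → b ≤ suc L → Rainbows s 0 b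
  rainbows-v {s} b val b≤ = replicate b v , counts-replicate-v b , subst Unique (sym (cols-replicate-v b s)) (unique-v b val b≤)

  -- In positive rows the colour B l occurs in column 1 + L only.
  reach-≢special : ∀ {j k t} → j < L → k ≤ suc L → Reach (2 + L) j k t → HCol t (B l) → ⊥
  reach-≢special {j} {k} j< k≤ (right p) q with refl ← n≤0⇒n≡0 (+-cancelˡ-≤ (2 + L) k 0 (≤-trans p (≡≥ (+-identityʳ (2 + L))))) =
    lin-⊥ 0 (proj₂ (B-column q) ⊕ ≡≥ L≡) (solve (l ∙ L ∙ ∅))
  reach-≢special {j} {k} j< k≤ (up {c} _ e _) q = lin-⊥ 0 (B-special (s≤s z≤n) q ⊕ ≡≥ e ⊕ k≤) (solve (c ∙ k ∙ L ∙ ∅))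
  reach-≢special j< _ (last j≡ _) _ = <-irrefl j≡ j<
  reach-≢special j< _ (over j≡ _ _) _ = <-irrefl j≡ j<

  -- The arcs v come first: they use `B l` and the colours A below row `j`, and the arcs h that
  -- follow start in row `j`, column `2 + L`.
  rainbows-corner : ∀ a b → a ≤ 2 + L → b ≤ L → Rainbows corner a b
  rainbows-corner a zero a≤ b≤ = rainbows-h a corner a≤
  rainbows-corner a (suc j) a≤ j< = rainbow-vh corner (suc j) a (at ≤-refl (<⇒≤ j<)) a≤ (vsteps-up j {2 + L} {0} (<⇒≤ j<))
    (run-corner (m≤n⇒m≤1+n (<⇒≤ j<)))
    (reach-avoid a ≤-refl (<⇒≤ j<) a≤ λ { k k< re p (row r<) → <⇒≱ r< (reach-≥ j< re p)
                                     ; k k< re p (special _) → reach-≢special j< (s≤s⁻¹ (≤-trans k< a≤)) re p })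

  reach-≤ : ∀ {u w k t r} → suc w < L → Reach u w k t → HCol t (A r) → r ≤ suc w
  reach-≤ {w = w} w< (right _) p = ≤-trans (≡≤ (A-row p (<⇒≤ w<))) (n≤1+n w)
  reach-≤ w< (up _ _ _) p = ≡≤ (A-row p w<)
  reach-≤ w< (last w≡ _) _ = ⊥-elim (<-irrefl w≡ (<⇒≤ w<))
  reach-≤ w< (over w≡ _ _) _ = ⊥-elim (<-irrefl w≡ (<⇒≤ w<))

  corner-avoid : ∀ {P : Colour → Set} a → a ≤ 2 + L → (P X₁ → ⊥) → (∀ k {c} → HCol (at k 0) c → P c → ⊥) →
    ∀ k → k < a → ∀ {c} → HCol (hsteps k corner) c → P c → ⊥
  corner-avoid a a≤ f g zero _ corner = f
  corner-avoid {P} a a≤ f g (suc k) k< p = g k (subst (λ t → HCol t _) (hsteps-right k {0} (≤-trans (n≤1+n k) (≤-trans (<⇒≤ k<) a≤))) p)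

  -- All arcs v come first. The arcs h then start in column 0 above the rows used, or at `corner`,
  -- where the only A met is `A 0` and `w > 0`, or in column `2 + L` of a row `j`, where only `A j`
  -- and `A (suc j)` are met and `suc j < w`.
  rainbows-first-column : ∀ {w} a b → w ≤ L → a ≤ 2 + L → b ≤ L → Rainbows (at 0 w) a b
  rainbows-first-column {w} a b w≤ a≤ b≤ with split b w≤
  ... | below w+b≤ = rainbow-vh (at 0 w) b a (at z≤n w+b≤) a≤ (vsteps-up b w+b≤) (run-up b (m≤n⇒m≤1+n w+b≤))
    (reach-avoid a z≤n w+b≤ a≤ λ
      { k k< (right _) p (row (_ , r<)) → <⇒≱ r< (A-above p (≤-trans k< a≤))
      ; k k< (up {c} _ e _) _ _ → lin-⊥ (suc c) (k< ⊕ a≤ ⊕ ≡≥ e) (solve (k ∙ a ∙ c ∙ L ∙ ∅))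
      ; k k< (last _ e) _ _ → lin-⊥ 1 (k< ⊕ a≤ ⊕ ≡≥ e) (solve (k ∙ a ∙ L ∙ ∅))
      ; k k< (over {c} _ e _) _ _ → lin-⊥ (2 + c) (k< ⊕ a≤ ⊕ ≡≥ e) (solve (k ∙ a ∙ c ∙ L ∙ ∅)) })
  ... | beyond d zero e refl = subst (Rainbows (at 0 w) a) (sym (+-identityʳ (suc d)))
    (rainbow-vh (at 0 w) (suc d) a corner a≤ (trans (vsteps-top d e) vstep-corner)
      (run-up (suc d) (≡≤ (trans (+-suc w d) (cong suc e))))
      (corner-avoid a a≤ (λ ()) λ { k p (row (w≤r , _)) →
        1+n≰n (≤-trans (beyond-≤ {w} {d} {0} b≤ e refl) (≤-trans w≤r (≡≤ (A-row p (≤-trans (s≤s z≤n) (≡≥ L≡)))))) }))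
  ... | beyond d (suc j) e refl = rainbow-vh (at 0 w) (suc d + suc j) a (at ≤-refl (<⇒≤ j<L)) a≤
    (end-corner d e (<⇒≤ j<L)) (run-through-corner d e (<⇒≤ (<⇒≤ j<w)))
    (reach-avoid a ≤-refl (<⇒≤ j<L) a≤ λ
      { k k< re p (row (inj₁ w≤r)) → 1+n≰n (≤-trans j<w (≤-trans w≤r (reach-≤ (≤-trans j<w w≤) re p)))
      ; k k< re p (row (inj₂ r<j)) → <⇒≱ r<j (reach-≥ j<L re p)
      ; k k< re p (special _) → reach-≢special j<L (s≤s⁻¹ (≤-trans k< a≤)) re p })
    where
    j<w : suc j < w
    j<w = beyond-≤ {w} {d} {suc j} b≤ e refl
    j<L : j < L
    j<L = ≤-trans (<⇒≤ j<w) w≤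

  -- The first arc v moves one column to the left, so even `2 + L` arcs h afterwards stay clear of
  -- the colour `A L` that it used.
  rainbows-last-row : ∀ {u} a b → suc u ≤ 2 + L → a ≤ 2 + L → b ≤ L → Rainbows (at (suc u) L) a b
  rainbows-last-row a zero u≤ a≤ _ = rainbows-h a (at u≤ ≤-refl) a≤
  rainbows-last-row {u} a (suc j) u≤ a≤ j< = rainbow-vh (at (suc u) L) (suc j) a (at (<⇒≤ u≤) (<⇒≤ j<)) a≤
    (end-left 0 (+-identityʳ L) (<⇒≤ j<)) (run-left 0 (+-identityʳ L) (<⇒≤ j<))
    (reach-avoid a (<⇒≤ u≤) (<⇒≤ j<) a≤ λ
      { k k< re p (row (inj₁ L≤r)) → <⇒≱ (reach-< {u} {j} {k} j< (lin 0 (u≤ ⊕ k< ⊕ a≤) (solve (u ∙ k ∙ a ∙ L ∙ ∅))) re p) L≤r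
      ; k k< re p (row (inj₂ r<j)) → <⇒≱ r<j (reach-≥ j< re p) })

  run-inner : ∀ {u w} b → w ≤ L → b ≤ L → Run (λ _ → ⊤) ⊥ (vcols b (at (suc u) w))
  run-inner {u} {w} b w≤ b≤ with split b w≤
  ... | below p = weaken _ (λ ()) (run-up b (m≤n⇒m≤1+n p))
  ... | beyond d j e refl = weaken _ (λ ()) (run-left d e (<⇒≤ (beyond-≤ {w} {d} {j} b≤ e refl)))

  -- The arcs h come first and lie strictly between the borders of their row, hence have no colour
  -- A; the arcs v start in a positive column, avoid `corner` and have only colours A.
  rainbows-within-row : ∀ {u w} a b → suc u + a ≤ 2 + L → w < L → b ≤ L → Rainbows (at (suc u) w) a b
  rainbows-within-row {u} {w} a b u+a≤ w< b≤ = rainbow-hv (at (suc u) w) a b (at u≤ (<⇒≤ w<)) a≤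
    (hsteps-right a u+a≤) (run-inner b (<⇒≤ w<) b≤)
    (reach-avoid a u≤ (<⇒≤ w<) a≤ λ
      { k k< (right q) p (row _) → [ (λ ()) , (λ (u≡ : suc u + k ≡ 2 + L) → lin-⊥ 0 (≡≥ u≡ ⊕ k< ⊕ u+a≤) (solve (u ∙ k ∙ a ∙ L ∙ ∅))) ] (A-border w< p)
      ; k k< (up {c} _ e _) _ _ → lin-⊥ (suc c) (≡≥ e ⊕ k< ⊕ u+a≤) (solve (u ∙ k ∙ a ∙ c ∙ L ∙ ∅))
      ; k k< (last w≡ _) _ _ → <-irrefl w≡ w<
      ; k k< (over w≡ _ _) _ _ → <-irrefl w≡ w< })
    where
    u≤ : suc u ≤ 2 + L
    u≤ = ≤-trans (m≤m+n (suc u) a) u+a≤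
    a≤ : a ≤ 2 + L
    a≤ = ≤-trans (m≤n+m a (suc u)) u+a≤

  -- The arcs h end in column 0 of the next row. If the arcs v can climb on from there without
  -- leaving row `L` by their number, the arcs h come first and the only A among them is `A w`.
  -- Otherwise the arcs v come first, and the arcs h stay in row `j` with at most `A j`, where
  -- `j < w`.
  rainbows-to-next-row : ∀ {u w} a b → suc u ≤ 2 + L → a ≤ 2 + L → suc u + a ≡ 3 + L → w < L → b ≤ L → Rainbows (at (suc u) w) a b
  rainbows-to-next-row {u} {w} a b u≤ a≤ u+a≡ w< b≤ with split b (<⇒≤ w<)
  ... | below w+b≤ = rainbow-hv (at (suc u) w) a b (at u≤ (<⇒≤ w<)) a≤
    (hsteps-up a {c = 0} w< u≤ (trans u+a≡ (sym (+-identityʳ (3 + L)))) z≤n) (run-up b (s≤s w+b≤))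
    (reach-avoid a u≤ (<⇒≤ w<) a≤ λ
      { k k< (right q) p (row (w<r , _)) → <-irrefl (sym (A-row p w<)) w<r
      ; k k< (up {c} _ e _) _ _ → lin-⊥ c (≡≥ e ⊕ k< ⊕ ≡≤ u+a≡) (solve (u ∙ k ∙ a ∙ c ∙ L ∙ ∅))
      ; k k< (last w≡ _) _ _ → <-irrefl w≡ w<
      ; k k< (over w≡ _ _) _ _ → <-irrefl w≡ w< })
  ... | beyond d j e refl = rainbow-vh (at (suc u) w) (suc d + j) a (at (<⇒≤ u≤) (<⇒≤ j<L)) a≤
    (end-left d e (<⇒≤ j<L)) (run-left d e (<⇒≤ j<w))
    (reach-avoid a (<⇒≤ u≤) (<⇒≤ j<L) a≤ λ
      { k k< (right q) p (row (inj₁ w≤r)) → <⇒≱ j<w (≤-trans w≤r (≡≤ (A-row p j<L)))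
      ; k k< (right q) p (row (inj₂ r<j)) → <-irrefl (A-row p j<L) r<j
      ; k k< (up {c} _ e _) _ _ → lin-⊥ (suc c) (≡≥ e ⊕ k< ⊕ ≡≤ u+a≡) (solve (u ∙ k ∙ a ∙ c ∙ L ∙ ∅))
      ; k k< (last j≡ _) _ _ → <-irrefl j≡ j<L
      ; k k< (over j≡ _ _) _ _ → <-irrefl j≡ j<L })
    where
    j<w : j < w
    j<w = beyond-≤ {w} {d} {j} b≤ e refl
    j<L : j < L
    j<L = ≤-trans j<w (<⇒≤ w<)

  -- The run of 2 + L arcs h would meet the colour A L in the last row, which the arc v above needs,
  -- so the word leaves that row one arc earlier and takes the arc h of colour B l in row 0.
  rainbows-detour : ∀ {w} i j → suc (w + i) ≡ L → j ≤ w → Rainbows (at (2 + L) w) (2 + L) (i + suc j)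
  rainbows-detour {w} i j e j≤ = subst (λ a → Rainbows (at (2 + L) w) a (i + suc j)) (+-comm (suc L) 1)
    (rainbow-word (at (2 + L) w) {at (2 + L) w′} i (suc L) (v ∷ h ∷ replicate j v) (at ≤-refl (<⇒≤ w′<)) (n≤1+n (suc L))
      (vsteps-up i (<⇒≤ w′<)) (v∷ (h∷ counts-replicate-v j)) (run-up i (m≤n⇒m≤1+n (<⇒≤ w′<)))
      (subst (λ t → Run R ⊤ (cols t (v ∷ h ∷ replicate j v))) (sym (hsteps-up (suc L) {c = L} w′< ≤-refl (+-suc (2 + L) L) (m≤n+m L 2))) tail)
      (λ { (_ , r<) (inj₁ L≤) → 1+n≰n (≤-trans r< (≤-trans (<⇒≤ w′<) L≤))
         ; (w≤ , _) (inj₂ r<j) → <⇒≱ r<j (≤-trans j≤ w≤) })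
      (λ ())
      (reach-avoid (suc L) ≤-refl (<⇒≤ w′<) (n≤1+n (suc L)) λ { k k< re p (row (_ , r<)) → <⇒≱ r< (reach-≥ w′< re p) })
      (reach-avoid (suc L) ≤-refl (<⇒≤ w′<) (n≤1+n (suc L)) λ
        { k k< re p (row (inj₁ L≤)) → <⇒≱ (reach-< {2 + L} {w′} {k} w′< (lin 0 k< (solve (k ∙ L ∙ ∅))) re p) L≤
        ; k k< re p (row (inj₂ r<j)) → <⇒≱ r<j (≤-trans j≤ (≤-trans (m≤m+n w i) (reach-≥ w′< re p)))
        ; k k< re p (special _) → reach-≢special w′< (<⇒≤ k<) re p }))
    where
    w′ : ℕ
    w′ = w + i
    w′< : w′ < L
    w′< = ≡≤ e
    R : ℕ → Set
    R r = L ≤ r ⊎ r < j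
    turn : vstep (at L L) ≡ at (suc l) 0
    turn = trans (cong (λ u → vstep (at u L)) L≡) vstep-left
    onward : hstep (at (suc l) 0) ≡ at (2 + l) 0
    onward = hstep-right (≤-trans (≡≥ L≡) (m≤n+m L 2))
    hcol-special : ∀ {c} → HCol (at (suc l) 0) c → c ≡ B l
    hcol-special (x₀ p) = ⊥-elim (lin-⊥ 0 (≡≥ p ⊕ ≡≥ L≡) (solve (l ∙ L ∙ ∅)))
    hcol-special (x₁ p) = ⊥-elim (lin-⊥ 1 (≡≥ p ⊕ ≡≥ L≡) (solve (l ∙ L ∙ ∅)))
    hcol-special (side _ (inj₂ p) _) = ⊥-elim (lin-⊥ 2 (≡≥ p ⊕ ≡≥ L≡) (solve (l ∙ L ∙ ∅)))
    hcol-special (lastL p _ _) = ⊥-elim (lin-⊥ (suc l) (≡≥ p ⊕ ≡≥ L≡) (solve (l ∙ L ∙ ∅)))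
    hcol-special (lastR p _ _) = ⊥-elim (lin-⊥ (suc l) (≡≥ p ⊕ ≡≥ L≡) (solve (l ∙ L ∙ ∅)))
    hcol-special (pre refl _) = refl
    hcol-special (mid _ p _) = ⊥-elim (lin-⊥ (suc l) (≡≥ p ⊕ ≡≥ L≡) (solve (l ∙ L ∙ ∅)))
    hcol-special {B i} (post p q _ _) = ⊥-elim (lin-⊥ 2 (≡≥ p ⊕ q ⊕ ≡≥ L≡) (solve (l ∙ i ∙ L ∙ ∅)))
    extend : Run (λ r → 0 ≤ r × r < j) ⊥ (vcols j (at (2 + l) 0)) →
             Run R ⊤ (A L ∷ hcol (at (suc l) 0) ∷ cols (at (2 + l) 0) (replicate j v))
    extend (uniq , all) rewrite hcol-special (hcol-HCol (at {suc l} {0} (≤-trans (n≤1+n (suc l)) (≤-trans (≡≥ L≡) (m≤n+m L 2))) z≤n))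
      | cols-replicate-v j (at (2 + l) 0) =
      ((λ ()) ∷ All.map (λ { (row (_ , r<j)) refl → 1+n≰n (≤-trans r<j (≤-trans j≤ (≤-trans (m≤m+n w i) (<⇒≤ w′<)))) }) all)
        ∷ All.map (λ { (row _) () }) all ∷ uniq
      , row (inj₁ ≤-refl) ∷ special tt ∷ proj₂ (weaken (inj₂ ∘ proj₂) (λ ()) (uniq , all))
    tail : Run R ⊤ (cols (at L (suc w′)) (v ∷ h ∷ replicate j v))
    tail rewrite e | turn | onward = extend (run-up j (≤-trans j≤ (≤-trans (m≤m+n w i) (m≤n⇒m≤1+n (<⇒≤ w′<)))))

  -- If `w + b < L`, all arcs v come first. Otherwise `i` of them lead to row `L - 1`, the arcs h go
  -- on to column `suc c` of the last row, and the remaining arcs v use `A L`, `A 0`, ...,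
  -- `A (j - 1)`. The arcs h meet `A L` only when both `suc u` and `a` equal `2 + L`.
  rainbows-across : ∀ {u w} a b c → suc u ≤ 2 + L → a ≤ 2 + L → suc u + a ≡ 4 + L + c → w < L → b ≤ L → Rainbows (at (suc u) w) a b
  rainbows-across {u} {w} a b c u≤ a≤ u+a≡ w< b≤ with suc (w + b) ≤? L
  ... | yes w+b< = rainbow-vh (at (suc u) w) b a (at u≤ (<⇒≤ w+b<)) a≤ (vsteps-up b (<⇒≤ w+b<)) (run-up b (m≤n⇒m≤1+n (<⇒≤ w+b<)))
    (reach-avoid a u≤ (<⇒≤ w+b<) a≤ λ { k k< re p (row (_ , r<)) → <⇒≱ r< (reach-≥ w+b< re p) })
  ... | no w+b≮ with i , e ← m≤n⇒∃[o]m+o≡n w<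
                with j , e′ ← m≤n⇒∃[o]m+o≡n {suc i} {b} (lin 0 (s≤s⁻¹ (≰⇒> w+b≮) ⊕ ≡≤ e) (solve (w ∙ i ∙ b ∙ L ∙ ∅)))
    = subst (Rainbows (at (suc u) w) a) (trans (+-suc i j) e′) (path (m≤n⇒m<n∨m≡n u≤) (m≤n⇒m<n∨m≡n a≤))
    where
    w′ : ℕ
    w′ = w + i
    w′< : w′ < L
    w′< = ≡≤ e
    j≤ : j ≤ w
    j≤ = lin 0 (b≤ ⊕ ≡≤ e′ ⊕ ≡≥ e) (solve (w ∙ i ∙ j ∙ b ∙ L ∙ ∅))
    c≤ : suc c ≤ 2 + L
    c≤ = lin 1 (u≤ ⊕ a≤ ⊕ ≡≥ u+a≡) (solve (u ∙ a ∙ c ∙ L ∙ ∅))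
    -- A positive column, so the next arc v leads to row 0 and not to `corner`.
    end : hsteps a (at (suc u) w′) ≡ at (suc c) L
    end = trans (hsteps-up a {c = suc c} w′< u≤ (trans u+a≡ (sym (+-suc (3 + L) c))) c≤) (cong (at (suc c)) e)
    direct : suc u + a < 4 + L + L → Rainbows (at (suc u) w) a (i + suc j)
    direct u+a< = rainbow-vhv (at (suc u) w) i a (suc j) (at u≤ (<⇒≤ w′<)) a≤ (vsteps-up i (<⇒≤ w′<)) end
      (run-up i (m≤n⇒m≤1+n (<⇒≤ w′<))) (run-left 0 (+-identityʳ L) (≤-trans j≤ (<⇒≤ w<)))
      (λ { (_ , r<) (inj₁ L≤) → 1+n≰n (≤-trans r< (≤-trans (<⇒≤ w′<) L≤))
         ; (w≤ , _) (inj₂ r<j) → <⇒≱ r<j (≤-trans j≤ w≤) })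
      (λ ())
      (reach-avoid a u≤ (<⇒≤ w′<) a≤ λ { k k< re p (row (_ , r<)) → <⇒≱ r< (reach-≥ w′< re p) })
      (reach-avoid a u≤ (<⇒≤ w′<) a≤ λ
        { k k< re p (row (inj₁ L≤)) → <⇒≱ (reach-< {suc u} {w′} {k} w′< (lin 0 (k< ⊕ u+a<) (solve (u ∙ a ∙ k ∙ L ∙ ∅))) re p) L≤
        ; k k< re p (row (inj₂ r<j)) → <⇒≱ r<j (≤-trans j≤ (≤-trans (m≤m+n w i) (reach-≥ w′< re p))) })
    path : suc u < 2 + L ⊎ suc u ≡ 2 + L → a < 2 + L ⊎ a ≡ 2 + L → Rainbows (at (suc u) w) a (i + suc j)
    path (inj₁ u<) _ = direct (lin 0 (u< ⊕ a≤) (solve (u ∙ a ∙ L ∙ ∅)))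
    path (inj₂ _) (inj₁ a<) = direct (lin 0 (u≤ ⊕ a<) (solve (u ∙ a ∙ L ∙ ∅)))
    path (inj₂ refl) (inj₂ refl) = rainbows-detour i j e j≤

  rainbows : ∀ {s} a b → Valid s → a ≤ 2 + L → b ≤ L → Rainbows s a b
  rainbows a b corner a≤ b≤ = rainbows-corner a b a≤ b≤
  rainbows a b (at {zero} u≤ w≤) a≤ b≤ = rainbows-first-column a b w≤ a≤ b≤
  rainbows a b (at {suc u} {w} u≤ w≤) a≤ b≤ with m≤n⇒m<n∨m≡n w≤
  ... | inj₂ refl = rainbows-last-row a b u≤ a≤ b≤
  ... | inj₁ w< with suc u + a ≤? 2 + L
  ...   | yes p = rainbows-within-row a b p w< b≤
  ...   | no ¬p with m≤n⇒∃[o]m+o≡n (≰⇒> ¬p)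
  ...     | zero , e = rainbows-to-next-row a b u≤ a≤ (trans (sym e) (+-identityʳ (3 + L))) w< b≤
  ...     | suc c , e = rainbows-across a b c u≤ a≤ (trans (sym e) (+-suc (3 + L) c)) w< b≤

-- The colouring of the circulant digraph

unique-map : ∀ {X Y : Set} {P : X → Set} {f : X → Y} → (∀ {x y} → P x → P y → f x ≡ f y → x ≡ y) →
             ∀ {xs} → All P xs → Unique xs → Unique (map f xs)
unique-map inj [] [] = []
unique-map inj (p ∷ ps) (x∉ ∷ u) =
  Allₚ.map⁺ (All.zipWith (λ (q , x≢y) eq → x≢y (inj p q eq)) (ps , x∉)) ∷ unique-map inj ps u

module General (l L : ℕ) (L≡ : L ≡ 2 + l) (n : ℕ) .{{_ : NonZero n}} (n≡ : n ≡ (2 + L) * (2 + L)) where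

  open Circulant L n n≡
  open Grid l L L≡

  counts-amount : ∀ {w a b} → Counts w a b → amount w ≡ target a b
  counts-amount [] = refl
  counts-amount (h∷ c) = cong suc (counts-amount c)
  counts-amount {a = a} {suc b} (v∷_ {w = w} c) = trans (cong (3 + L +_) (counts-amount c)) (lemma (b * (3 + L)))
    where
    lemma : ∀ m → 3 + L + (a + m) ≡ a + (3 + L + m)
    lemma m = solve (L ∙ a ∙ m ∙ ∅)

  decode : ℕ → Cell
  decode x = hsteps x (at 0 0)

  decode-valid : ∀ x → Valid (decode x)
  decode-valid x = hsteps-valid x (at z≤n z≤n)

  decode-* : ∀ q → decode (q * n) ≡ at 0 0
  decode-* zero = refl
  decode-* (suc q) = trans (hsteps-+ n (q * n) (at 0 0))
    (trans (cong (hsteps (q * n)) (trans (cong decode n≡) hsteps-period)) (decode-* q))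

  decode-% : ∀ x → decode (x % n) ≡ decode x
  decode-% x = begin
    decode (x % n)                    ≡⟨ cong (hsteps (x % n)) (decode-* (x / n)) ⟨
    hsteps (x % n) (decode (x / n * n)) ≡⟨ hsteps-+ (x / n * n) (x % n) (at 0 0) ⟨
    decode (x / n * n + x % n)        ≡⟨ cong decode (trans (+-comm (x / n * n) (x % n)) (sym (m≡m%n+[m/n]*n x n))) ⟩
    decode x                          ∎
    where open ≡-Reasoning

  step : Step → Cell → Cell
  step h = hstep
  step v = vstep

  step≡hsteps : ∀ s {t} → Valid t → hsteps (size s) t ≡ step s t
  step≡hsteps h _ = refl
  step≡hsteps v val = sym (vstep≡hsteps val)

  decode-next : ∀ x s → decode (toℕ (next x s)) ≡ step s (decode (toℕ x))
  decode-next x s = begin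
    decode (toℕ (next x s))              ≡⟨ cong decode (toℕ-mod (toℕ x + size s)) ⟩
    decode ((toℕ x + size s) % n)        ≡⟨ decode-% (toℕ x + size s) ⟩
    decode (toℕ x + size s)              ≡⟨ hsteps-+ (toℕ x) (size s) (at 0 0) ⟩
    hsteps (size s) (decode (toℕ x))     ≡⟨ step≡hsteps s (decode-valid (toℕ x)) ⟩
    step s (decode (toℕ x))              ∎
    where open ≡-Reasoning

  -- The palette: two colours X, `1 + L` colours A and `L - 1` colours B, together `2 + L + L`.
  data Proper : Colour → Set where
    X₀ : Proper X₀
    X₁ : Proper X₁
    A : ∀ {r} → r ≤ L → Proper (A r)
    B : ∀ {i} → 2 + i ≤ L → Proper (B i)

  hcol-proper : ∀ {s c} → Valid s → HCol s c → Proper c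
  hcol-proper _ corner = X₁
  hcol-proper _ (x₀ _) = X₀
  hcol-proper _ (x₁ _) = X₁
  hcol-proper _ (side w< _ refl) = A (<⇒≤ w<)
  hcol-proper _ (lastL _ _ refl) = A ≤-refl
  hcol-proper _ (lastR _ _ r≡) = A (≤-trans (n≤1+n _) (≡≤ r≡))
  hcol-proper _ (pre {i = i} _ p) = B (≤-trans (m≤m+n (2 + i) _) p)
  hcol-proper _ (mid _ _ p) = B (<⇒≤ p)
  hcol-proper _ (post _ _ p _) = B p

  vcol-proper : ∀ {s} → Valid s → Proper (vcol s)
  vcol-proper corner = B (≡≥ L≡)
  vcol-proper (at _ w≤) = A w≤

  cols-proper : ∀ {s} w → Valid s → All Proper (cols s w)
  cols-proper [] _ = []
  cols-proper (h ∷ w) val = hcol-proper val (hcol-HCol val) ∷ cols-proper w (hstep-valid val)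
  cols-proper (v ∷ w) val = vcol-proper val ∷ cols-proper w (vstep-valid val)

  encode : Colour → ℕ
  encode X₀ = 0
  encode X₁ = 1
  encode (A r) = 2 + r
  encode (B i) = 3 + L + i

  encode-< : ∀ {c} → Proper c → encode c < 2 + L + L
  encode-< X₀ = s≤s z≤n
  encode-< X₁ = s≤s (s≤s z≤n)
  encode-< (A {r} r≤) = lin {3 + r} {2 + L + L} (suc l) (r≤ ⊕ ≡≥ L≡) (solve (r ∙ l ∙ L ∙ ∅))
  encode-< (B {i} i≤) = lin {4 + L + i} {2 + L + L} 0 i≤ (solve (i ∙ L ∙ ∅))

  A≢B : ∀ {r i} → r ≤ L → 2 + r ≢ 3 + L + i
  A≢B {r} {i} r≤ eq = lin-⊥ i (r≤ ⊕ ≡≥ eq) (solve (r ∙ i ∙ L ∙ ∅))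

  encode-injective : ∀ {c c′} → Proper c → Proper c′ → encode c ≡ encode c′ → c ≡ c′
  encode-injective X₀ X₀ _ = refl
  encode-injective X₁ X₁ _ = refl
  encode-injective (A _) (A _) refl = refl
  encode-injective (B _) (B _) eq = cong B (+-cancelˡ-≡ (3 + L) _ _ eq)
  encode-injective (A r≤) (B _) eq = ⊥-elim (A≢B r≤ eq)
  encode-injective (B _) (A r≤) eq = ⊥-elim (A≢B r≤ (sym eq))

  paint : Colour → Fin (2 + L + L)
  paint c = encode c mod (2 + L + L)

  paint-injective : ∀ {c c′} → Proper c → Proper c′ → paint c ≡ paint c′ → c ≡ c′
  paint-injective p p′ eq = encode-injective p p′ (trans (sym (toℕ-paint p)) (trans (cong toℕ eq) (toℕ-paint p′)))
    where
    toℕ-paint : ∀ {c} → Proper c → toℕ (paint c) ≡ encode c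
    toℕ-paint {c} p = trans (Finₚ.toℕ-fromℕ< (m%n<n (encode c) (2 + L + L))) (m<n⇒m%n≡m (encode-< p))

  arcColour : Step → Fin n → Fin (2 + L + L)
  arcColour h x = paint (hcol (decode (toℕ x)))
  arcColour v x = paint (vcol (decode (toℕ x)))

  colours≡cols : ∀ x w → colours arcColour x w ≡ map paint (cols (decode (toℕ x)) w)
  colours≡cols x [] = refl
  colours≡cols x (h ∷ w) = cong (_ ∷_) (trans (colours≡cols (next x h) w) (cong (λ t → map paint (cols t w)) (decode-next x h)))
  colours≡cols x (v ∷ w) = cong (_ ∷_) (trans (colours≡cols (next x v) w) (cong (λ t → map paint (cols t w)) (decode-next x v)))

  strong : StronglyRainbowConnectable Arc (2 + L + L)
  strong = stronglyConnectable arcColour λ x a b reg → rainbowWord x (rainbows-region (decode-valid (toℕ x)) reg)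
    where
    rainbows-region : ∀ {s a b} → Valid s → Region a b → Rainbows s a b
    rainbows-region val (inj₁ (a≤ , b≤)) = rainbows _ _ val a≤ b≤
    rainbows-region val (inj₂ (refl , refl)) = rainbows-v (suc L) val ≤-refl
    rainbowWord : ∀ x {a b} → Rainbows (decode (toℕ x)) a b → RainbowWord arcColour x a b
    rainbowWord x {a} {b} (w , counts , uniq) = w
      , Finₚ.toℕ-injective (trans (toℕ-follow x w) (trans (cong (λ d → (toℕ x + d) % n) (counts-amount counts)) (sym (toℕ-mod (toℕ x + target a b)))))
      , counts-length counts
      , subst Unique (sym (colours≡cols x w)) (unique-map paint-injective (cols-proper w (decode-valid (toℕ x))) uniq)

-- Exhaustive search for `m = 2` and `m = 3`.

words : ℕ → List (List Step)
words zero = [] ∷ []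
words (suc t) = map (h ∷_) (words t) ++ map (v ∷_) (words t)

module Search (L n : ℕ) .{{_ : NonZero n}} (n≡ : n ≡ (2 + L) * (2 + L)) {K : ℕ} (c : Step → Fin n → Fin K) where

  open Circulant L n n≡

  Found : Fin n → ℕ → ℕ → Set
  Found x a b = Any (λ w → follow x w ≡ (toℕ x + target a b) mod n × length w ≡ a + b × Unique (colours c x w)) (words (a + b))

  found? : ∀ x a b → Dec (Found x a b)
  found? x a b = Any.any? (λ w → follow x w Finₚ.≟ _ ×-dec length w ≟ a + b ×-dec unique? Finₚ._≟_ (colours c x w)) (words (a + b))

  all-found? : Dec ((∀ x (a : Fin (3 + L)) (b : Fin (suc L)) → Found x (toℕ a) (toℕ b)) × (∀ x → Found x 0 (suc L)))
  all-found? = Finₚ.all? (λ x → Finₚ.all? λ a → Finₚ.all? λ b → found? x (toℕ a) (toℕ b)) ×-dec Finₚ.all? (λ x → found? x 0 (suc L))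

  strong : True all-found? → StronglyRainbowConnectable Arc K
  strong ok = stronglyConnectable c λ where
    x a b (inj₁ (a≤ , b≤)) → Any.satisfied (subst₂ (Found x) (Finₚ.toℕ-fromℕ< (s≤s a≤)) (Finₚ.toℕ-fromℕ< (s≤s b≤))
      (proj₁ (toWitness ok) x (fromℕ< (s≤s a≤)) (fromℕ< (s≤s b≤))))
    x _ _ (inj₂ (refl , refl)) → Any.satisfied (proj₂ (toWitness ok) x)

-- Visibly a successor, to match the number of vertices in the theorem; it computes to
-- `(2 + L) * (2 + L)`.
order : ℕ → ℕ
order L = suc ((2 + L) * (2 + L) ∸ 1)

strong : ∀ L → StronglyRainbowConnectable (Circulant.Arc L (order L) refl) (2 + L + L)
strong 0 = Search.strong 0 4 refl c tt
  where
  c : Step → Fin 4 → Fin 2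
  -- Both sizes, 1 and 3, are odd and `n` is even, so consecutive arcs differ in colour; no word
  -- here has more than two arcs.
  c _ x = toℕ x mod 2
strong 1 = Search.strong 1 9 refl c tt
  where
  -- Found by computer search.
  colour : Step → Vec ℕ 9
  colour h = 0 ∷ 1 ∷ 0 ∷ 1 ∷ 0 ∷ 1 ∷ 0 ∷ 2 ∷ 3 ∷ []
  colour v = 0 ∷ 1 ∷ 2 ∷ 1 ∷ 2 ∷ 3 ∷ 0 ∷ 0 ∷ 3 ∷ []
  c : Step → Fin 9 → Fin 4
  c s x = Vec.lookup (colour s) x mod 4
strong (suc (suc l)) = General.strong l (2 + l) refl (order (2 + l)) refl

-- Both parameters for `k = 3 + L`, where `2 * k ∸ 4` is `2 + L + L`.

theorem10 : (k : ℕ) → 3 ≤ k →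
    SRC* (CirculantArc (suc ((k ∸ 1) * (k ∸ 1) ∸ 1)) (1 ∷ k ∷ [])) (2 * k ∸ 4)
    × RC* (CirculantArc (suc ((k ∸ 1) * (k ∸ 1) ∸ 1)) (1 ∷ k ∷ [])) (2 * k ∸ 4)
theorem10 (suc (suc (suc L))) (s≤s (s≤s (s≤s z≤n))) =
  subst (λ m → SRC* Arc m × RC* Arc m) (sym (trans (cong (_∸ 4) (double L)) (m+n∸n≡m (2 + L + L) 4))) (minimum (strong L))
  where
  open Circulant L (order L) refl
  double : ∀ L → 2 * (3 + L) ≡ 2 + L + L + 4
  double L = solve (L ∙ ∅)
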